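{- Let $m>2$ be an integer, and let $C(t)=\sum_{n\ge0}\frac{1}{n+1}\binom{2n}{n}t^n$. For a pattern $\gamma$ put $$F_\gamma(t)=\sum_{n\ge0}\Big(\sum_{\sigma\in\mathcal{S}_n(132)}\mathrm{occr}_\gamma(\sigma)\Big)t^n,\qquad G_\gamma(t)=\sum_{n\ge0}\Big(\sum_{\sigma\in\mathcal{S}_n(123)}\mathrm{occr}_\gamma(\sigma)\Big)t^n.$$ Then $$F_{12\cdots m}(t)=\frac{t\,C(t)\,F_{12\cdots(m-1)}(t)}{1-2t\,C(t)}\qquad\text{and}\qquad G_{1m(m-1)\cdots2}(t)=\frac{t\,C(t)\,G_{1(m-1)(m-2)\cdots2}(t)}{1-2t\,C(t)}.$$
   Context: $\mathcal{S}_n$ is the set of permutations of $\{1,\ldots,n\}$ in one-line notation ($\mathcal{S}_0$ consists of the empty permutation). For a sequence $w$ of distinct integers, $\mathrm{red}(w)$ is the permutation obtained by replacing the $i$-th smallest entry of $w$ by $i$. For $\tau\in\mathcal{S}_j$ and $\sigma=\sigma_1\cdots\sigma_n\in\mathcal{S}_n$, $\mathrm{occr}_\tau(\sigma)$ is the number of index sets $1\le i_1<\cdots<i_j\le n$ with $\mathrm{red}(\sigma_{i_1}\cdots\sigma_{i_j})=\tau$. $\mathcal{S}_n(\tau)$ is the set of $\sigma\in\mathcal{S}_n$ with $\mathrm{occr}_\tau(\sigma)=0$. For $j\ge2$, $12\cdots j$ is the increasing pattern of length $j$, and $1j(j-1)\cdots2$ is the pattern of length $j$ with first entry $1$ followed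 by $j,j-1,\ldots,2$ (so $12$ for $j=2$, $132$ for $j=3$). All identities are between formal power series in $t$. -}

module Defs where

open import Data.Fin.Base using (toℕ)
open import Data.Integer.Base using (+_)
open import Data.List.Base
  using (List; []; _∷_; _++_; map; filter; length; applyUpTo; applyDownFrom; cartesianProductWith)
open import Data.List.Properties using (≡-dec)
import Data.List.Relation.Unary.Unique.DecPropositional as UniqueDec
open import Data.Nat.Base as ℕ using (ℕ; zero; suc; _∸_)
import Data.Nat.Combinatorics as Comb
open import Data.Nat.ListAction using (sum)
import Data.Nat.Properties as ℕ
open import Data.Rational.Base as ℚ using (ℚ; 0ℚ; 1ℚ)
import Data.Rational.Properties as ℚ
import Algebra.Properties.CommutativeMonoid.Sum ℚ.+-0-commutativeMonoid as Sum
open import Relation.Binary.PropositionalEquality using (_≗_; cong; module ≡-Reasoning)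

open UniqueDec ℕ._≟_ using (unique?)

Word : Set
Word = List ℕ

words : List ℕ → ℕ → List Word
words A zero    = [] ∷ []
words A (suc k) = cartesianProductWith _∷_ A (words A k)

-- A repetition-free list of the permutations of {1, …, n}: the words of
-- length n over {1, …, n} with distinct entries.
𝒮 : ℕ → List Word
𝒮 n = filter unique? (words (applyUpTo suc n) n)

-- In a word with distinct entries, x is the i-th smallest entry exactly
-- when i of the entries are at most x.
red : Word → Word
red w = map (λ x → length (filter (ℕ._≤? x) w)) w

-- The subwords σ_{i₁} ⋯ σ_{iⱼ}, listed once for each index set
-- i₁ < ⋯ < iⱼ.
subwords : ℕ → Word → List Word
subwords zero    σ       = [] ∷ []
subwords (suc j) []      = []
subwords (suc j) (x ∷ σ) = map (x ∷_) (subwords j σ) ++ subwords (suc j) σ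

occr : Word → Word → ℕ
occr τ σ = length (filter (λ w → ≡-dec ℕ._≟_ (red w) τ) (subwords (length τ) σ))

𝒮-avoiding : Word → ℕ → List Word
𝒮-avoiding τ n = filter (λ σ → occr τ σ ℕ.≟ 0) (𝒮 n)

increasing : ℕ → Word
increasing j = applyUpTo suc j

-- The pattern 1 j (j-1) ⋯ 2; only meaningful for j ≥ 2.
one-then-decreasing : ℕ → Word
one-then-decreasing j = 1 ∷ applyDownFrom (2 ℕ.+_) (j ∸ 1)

-- Formal power series over ℚ, given by their coefficients and compared
-- by pointwise equality _≗_.
Series : Set
Series = ℕ → ℚ

infixl 7 _*_ _/_
infixl 6 _-_

constant : ℚ → Series
constant q zero    = q
constant q (suc n) = 0ℚ

t : Series
t 1 = 1ℚ
t _ = 0ℚ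

_-_ : Series → Series → Series
(f - g) n = f n ℚ.- g n

_*_ : Series → Series → Series
(f * g) n = Sum.sum {suc n} λ i → f (toℕ i) ℚ.* g (n ∸ toℕ i)

-- Long division: with q = f₀ / g₀, the constant term of f - q g vanishes
-- and f / g = q + t (((f - q g) / t) / g).
_/_ : (f g : Series) .{{_ : ℚ.NonZero (g 0)}} → Series
(f / g) zero    = f 0 ℚ.÷ g 0
(f / g) (suc n) = ((λ k → f (suc k) ℚ.- (f 0 ℚ.÷ g 0) ℚ.* g (suc k)) / g) n

/-*-cancel : ∀ f g .{{_ : ℚ.NonZero (g 0)}} → (f / g) * g ≗ f
/-*-cancel f g zero = begin
  f 0 ℚ.* (ℚ.1/ g 0) ℚ.* g 0 ℚ.+ 0ℚ  ≡⟨ ℚ.+-identityʳ _ ⟩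
  f 0 ℚ.* (ℚ.1/ g 0) ℚ.* g 0         ≡⟨ ℚ.*-assoc (f 0) (ℚ.1/ g 0) (g 0) ⟩
  f 0 ℚ.* ((ℚ.1/ g 0) ℚ.* g 0)       ≡⟨ cong (f 0 ℚ.*_) (ℚ.*-inverseˡ (g 0)) ⟩
  f 0 ℚ.* 1ℚ                         ≡⟨ ℚ.*-identityʳ (f 0) ⟩
  f 0                                ∎
  where open ≡-Reasoning
/-*-cancel f g (suc n) = begin
  a ℚ.+ (f′ / g * g) n               ≡⟨ cong (a ℚ.+_) (/-*-cancel f′ g n) ⟩
  a ℚ.+ (f (suc n) ℚ.- a)            ≡⟨ ℚ.+-comm a _ ⟩
  f (suc n) ℚ.- a ℚ.+ a              ≡⟨ ℚ.+-assoc (f (suc n)) (ℚ.- a) a ⟩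
  f (suc n) ℚ.+ (ℚ.- a ℚ.+ a)        ≡⟨ cong (f (suc n) ℚ.+_) (ℚ.+-inverseˡ a) ⟩
  f (suc n) ℚ.+ 0ℚ                   ≡⟨ ℚ.+-identityʳ (f (suc n)) ⟩
  f (suc n)                          ∎
  where
  open ≡-Reasoning
  f′ : Series
  f′ k = f (suc k) ℚ.- (f 0 ℚ.÷ g 0) ℚ.* g (suc k)
  a : ℚ
  a = (f 0 ℚ.÷ g 0) ℚ.* g (suc n)

C : Series
C n = (+ 1 ℚ./ suc n) ℚ.* (+ ((2 ℕ.* n) Comb.C n) ℚ./ 1)

-- Σₙ (Σ_{σ ∈ 𝒮ₙ(τ)} occr γ σ) tⁿ
occurrences : (τ γ : Word) → Series
occurrences τ γ n = + sum (map (occr γ) (𝒮-avoiding τ n)) ℚ./ 1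

F : Word → Series
F = occurrences (1 ∷ 3 ∷ 2 ∷ [])

G : Word → Series
G = occurrences (1 ∷ 2 ∷ 3 ∷ [])

one two : Series
one = constant 1ℚ
two = constant (+ 2 ℚ./ 1)

{-# OPTIONS --safe #-}
-- Call the number k of larger letters to the right of a letter its height. In a
-- 132-avoiding (123-avoiding) permutation these larger letters are increasing
-- (decreasing), so a letter of height k starts exactly C(k, m - 1) occurrences of 12⋯m
-- (of 1m⋯2), and Σ occr = Σ C(height, m - 1).
--
-- Build the permutations by prepending letters: a letter of height k may be prepended
-- exactly when the k largest letters so far are sorted. If d is the largest such k, the
-- new value of d is k + 1 in the increasing case, and k or (for k = 0) d + 1 in the
-- decreasing case; either way the values are 1, …, d + 1, which is the Catalan
-- generating tree. A path in the tree starting at label a + b + 1 is a path starting at a,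
-- raised by b + 1, followed by a path starting at b. For the weighted counts this gives,
-- at a = b = 0, W₀ = t W₁ and W₁ = C W₀⁺ + C W₀, where W⁺ has the weights
-- C(k + 1, m - 1) = C(k, m - 1) + C(k, m - 2); so W₀ = t C (2 W₀ + V₀), where V has the
-- weights C(k, m - 2).
module Submission where

open import Defs
open import Data.Nat.Base using (ℕ; _∸_; _>_)
open import Data.Product.Base using (_×_)
open import Relation.Binary.PropositionalEquality using (_≗_)

import Data.Integer.Base as ℤ
import Data.Integer.Properties as ℤ
open import Data.List.Base
  using (List; []; _∷_; _++_; map; filter; length; applyUpTo; applyDownFrom; cartesianProductWith)
open import Data.List.Membership.Propositional using (_∈_)
open import Data.List.Membership.Propositional.Properties
  using (∈-map⁺; ∈-filter⁺; ∈-filter⁻; ∈-applyUpTo⁺; ∈-applyUpTo⁻; ∈-cartesianProductWith⁺; ∈-cartesianProductWith⁻)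
open import Data.List.Membership.Propositional.Properties.WithK using (unique∧set⇒bag)
open import Data.List.Properties
  using (≡-dec; filter-++; length-++; length-map; filter-accept; filter-reject; filter-none; filter-all;
         map-++; map-cong-local; map-∘; map-injective; map-applyUpTo; map-applyDownFrom;
         length-applyUpTo; length-applyDownFrom; ∷-injective)
open import Data.List.Relation.Binary.BagAndSetEquality using (∼bag⇒↭)
open import Data.List.Relation.Binary.Permutation.Propositional using (_↭_)
open import Data.List.Relation.Binary.Permutation.Propositional.Properties using (filter-↭; map⁺)
open import Data.List.Relation.Unary.All using (All; []; _∷_; all?)
import Data.List.Relation.Unary.All as All
import Data.List.Relation.Unary.All.Properties as All
open import Data.List.Relation.Unary.AllPairs using (AllPairs; []; _∷_; allPairs?)
import Data.List.Relation.Unary.AllPairs as AllPairs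
import Data.List.Relation.Unary.AllPairs.Properties as AllPairs
open import Data.List.Relation.Unary.Any using (here; there)
import Data.List.Relation.Unary.Unique.DecPropositional as UniqueDec
open import Data.List.Relation.Unary.Unique.Propositional using (Unique)
import Data.List.Relation.Unary.Unique.Propositional.Properties as Unique
open import Data.Nat.Base using (zero; suc; _+_; _≤_; _<_; z≤n; s≤s) renaming (_*_ to _·_)
open import Data.Nat.Combinatorics
  using (nC1≡n; nCk≡nC[n∸k]; nCk+nC[k+1]≡[n+1]C[k+1]) renaming (_C_ to _choose_)
open import Data.Nat.ListAction using (sum)
open import Data.Nat.ListAction.Properties using (sum-++; sum-↭)
open import Data.Nat.Properties
open import Data.Nat.Tactic.RingSolver using (solve-∀)
open import Data.Product.Base using (_,_; proj₁; proj₂; ∃; ∃₂)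
open import Data.Rational.Base as ℚ using (ℚ; 0ℚ; 1ℚ; toℚᵘ)
import Data.Rational.Properties as ℚ
open import Data.Rational.Unnormalised.Base as ℚᵘ using (mkℚᵘ; *≡*)
import Data.Rational.Unnormalised.Properties as ℚᵘ
open import Data.Sum.Base using (inj₁; inj₂)
open import Data.Unit.Base using (⊤; tt)
open import Function.Base using (_∘_; _$_)
open import Function.Bundles using (mk⇔)
open import Relation.Binary.PropositionalEquality
  using (_≡_; _≢_; refl; sym; trans; cong; cong₂; subst; ≢-sym; module ≡-Reasoning)
import Relation.Binary.Reasoning.Setoid as SetoidReasoning
open import Relation.Nullary using (¬_; Dec; yes; no; contradiction)
open import Relation.Nullary.Decidable using (_×-dec_)
open import Relation.Unary using (Decidable)

open UniqueDec _≟_ using (unique?)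

-- Finite sums and convolutions

-- The bound is inclusive, to match a node labelled d having d + 1 children.
sumTo : (ℕ → ℕ) → ℕ → ℕ
sumTo f zero    = f 0
sumTo f (suc d) = sumTo f d + f (suc d)

sumTo-cong : ∀ {f g} → f ≗ g → ∀ d → sumTo f d ≡ sumTo g d
sumTo-cong f≗g zero    = f≗g 0
sumTo-cong f≗g (suc d) = cong₂ _+_ (sumTo-cong f≗g d) (f≗g (suc d))

sumTo-cong-≤ : ∀ {f g} d → (∀ k → k ≤ d → f k ≡ g k) → sumTo f d ≡ sumTo g d
sumTo-cong-≤ zero    f≡g = f≡g 0 z≤n
sumTo-cong-≤ (suc d) f≡g =
  cong₂ _+_ (sumTo-cong-≤ d (λ k k≤d → f≡g k (m≤n⇒m≤1+n k≤d))) (f≡g (suc d) ≤-refl)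

sumTo-+ : ∀ f g d → sumTo (λ k → f k + g k) d ≡ sumTo f d + sumTo g d
sumTo-+ f g zero    = refl
sumTo-+ f g (suc d) rewrite sumTo-+ f g d =
  interchange (sumTo f d) (sumTo g d) (f (suc d)) (g (suc d))
  where
  interchange : ∀ a b c e → a + b + (c + e) ≡ a + c + (b + e)
  interchange = solve-∀

sumTo-*ˡ : ∀ c f d → sumTo (λ k → c · f k) d ≡ c · sumTo f d
sumTo-*ˡ c f zero    = refl
sumTo-*ˡ c f (suc d) rewrite sumTo-*ˡ c f d = sym (*-distribˡ-+ c (sumTo f d) (f (suc d)))

sumTo-head : ∀ f d → sumTo f (suc d) ≡ f 0 + sumTo (f ∘ suc) d
sumTo-head f zero    = refl
sumTo-head f (suc d) rewrite sumTo-head f d = +-assoc (f 0) _ _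

sumTo-split : ∀ f a b → sumTo f (suc (a + b)) ≡ sumTo f b + sumTo (λ k → f (suc (k + b))) a
sumTo-split f zero    b = refl
sumTo-split f (suc a) b rewrite sumTo-split f a b = +-assoc (sumTo f b) _ _

infixl 7 _⊛_

-- The Cauchy product. Peeling off the constant coefficient of the left factor is also how `_*_` on
-- series unfolds, so `fromℕ-⊛` can follow the same recursion.
_⊛_ : (f g : ℕ → ℕ) → ℕ → ℕ
(f ⊛ g) zero    = f 0 · g 0
(f ⊛ g) (suc n) = f 0 · g (suc n) + ((f ∘ suc) ⊛ g) n

⊛-cong : ∀ {f f′ g g′} → f ≗ f′ → g ≗ g′ → f ⊛ g ≗ f′ ⊛ g′
⊛-cong f≗ g≗ zero    = cong₂ _·_ (f≗ 0) (g≗ 0)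
⊛-cong f≗ g≗ (suc n) =
  cong₂ _+_ (cong₂ _·_ (f≗ 0) (g≗ (suc n))) (⊛-cong (f≗ ∘ suc) g≗ n)

⊛-distribʳ-+ : ∀ h f g n → ((λ i → f i + g i) ⊛ h) n ≡ (f ⊛ h) n + (g ⊛ h) n
⊛-distribʳ-+ h f g zero    = *-distribʳ-+ (h 0) (f 0) (g 0)
⊛-distribʳ-+ h f g (suc n) rewrite ⊛-distribʳ-+ h (f ∘ suc) (g ∘ suc) n =
  rearrange (f 0) (g 0) (h (suc n)) _ _
  where
  rearrange : ∀ a b c x y → (a + b) · c + (x + y) ≡ a · c + x + (b · c + y)
  rearrange = solve-∀

⊛-*ˡ : ∀ c f g n → ((λ i → c · f i) ⊛ g) n ≡ c · (f ⊛ g) n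
⊛-*ˡ c f g zero    = *-assoc c (f 0) (g 0)
⊛-*ˡ c f g (suc n) rewrite ⊛-*ˡ c (f ∘ suc) g n = rearrange c (f 0) (g (suc n)) _
  where
  rearrange : ∀ c a b x → c · a · b + c · x ≡ c · (a · b + x)
  rearrange = solve-∀

⊛-sumToˡ : ∀ (f : ℕ → ℕ → ℕ) g d n →
           ((λ i → sumTo (λ k → f k i) d) ⊛ g) n ≡ sumTo (λ k → (f k ⊛ g) n) d
⊛-sumToˡ f g zero    n = refl
⊛-sumToˡ f g (suc d) n =
  trans (⊛-distribʳ-+ g _ (f (suc d)) n) (cong (_+ (f (suc d) ⊛ g) n) (⊛-sumToˡ f g d n))

-- Peels the other end of the convolution, so that the two factors can exchange roles in `⊛-comm`.
⊛-last : ∀ f g n → (f ⊛ g) (suc n) ≡ f (suc n) · g 0 + (f ⊛ (g ∘ suc)) n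
⊛-last f g zero    = +-comm (f 0 · g 1) (f 1 · g 0)
⊛-last f g (suc n) rewrite ⊛-last (f ∘ suc) g n =
  x+[y+z] (f 0 · g (suc (suc n))) (f (suc (suc n)) · g 0) _
  where
  x+[y+z] : ∀ x y z → x + (y + z) ≡ y + (x + z)
  x+[y+z] = solve-∀

⊛-comm : ∀ f g → f ⊛ g ≗ g ⊛ f
⊛-comm f g zero    = *-comm (f 0) (g 0)
⊛-comm f g (suc n) = trans
  (cong₂ _+_ (*-comm (f 0) (g (suc n))) (⊛-comm (f ∘ suc) g n))
  (sym (⊛-last g f n))

-- Weighted paths in the Catalan tree

-- paths d r counts the paths of length r from a node labelled d in the tree in which
-- the children of such a node are labelled 1, …, d + 1.
paths : ℕ → ℕ → ℕ
paths d zero    = 1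
paths d (suc r) = sumTo (λ k → paths (suc k) r) d

-- In terms of generating functions, paths d = C^(d+1).
paths-⊛ : ∀ r a b → paths (suc (a + b)) r ≡ (paths a ⊛ paths b) r
paths-⊛ zero    a b = refl
paths-⊛ (suc r) a b = begin
  sumTo (λ k → paths (suc k) r) (suc (a + b))
    ≡⟨ sumTo-split (λ k → paths (suc k) r) a b ⟩
  paths b (suc r) + sumTo (λ k → paths (suc (suc (k + b))) r) a
    ≡⟨ cong (paths b (suc r) +_) (sumTo-cong (λ k → paths-⊛ r (suc k) b) a) ⟩
  paths b (suc r) + sumTo (λ k → (paths (suc k) ⊛ paths b) r) a
    -- Since `paths a 0` is 1, the first summand is the term of the convolution in which the raised
    -- part of the path has length 0.
    ≡⟨ cong₂ _+_ (sym (*-identityˡ _)) (sym (⊛-sumToˡ (paths ∘ suc) (paths b) a r)) ⟩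
  (paths a ⊛ paths b) (suc r)
    ∎
  where open ≡-Reasoning

-- `p k r` is the number of continuations of length r after a letter of height k. It stays abstract
-- to serve both directions: it becomes `paths (suc k)` for `up` and `paths k` for `down`, and both
-- factor when k is raised by b + 1.
module Weighted (p : ℕ → ℕ → ℕ)
                (p-⊛ : ∀ k b r → p (suc (k + b)) r ≡ (p k ⊛ paths b) r) where

  -- In direction `up` this adds the weights of all steps over all paths of length r from label d:
  -- the step to label k + 1 has weight `w k` and is shared by `p k r` paths. In direction `down`
  -- the same formula results once heights and labels are summed separately, see `sumTo-child`.
  total : (ℕ → ℕ) → ℕ → ℕ → ℕ
  total w d zero    = 0
  total w d (suc r) = sumTo (λ k → w k · p k r + total w (suc k) r) d

  total-cong : ∀ {w v} → w ≗ v → ∀ r d → total w d r ≡ total v d r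
  total-cong w≗v zero    d = refl
  total-cong w≗v (suc r) d = sumTo-cong
    (λ k → cong₂ _+_ (cong (_· p k r) (w≗v k)) (total-cong w≗v r (suc k))) d

  total-+ : ∀ w v r d → total (λ k → w k + v k) d r ≡ total w d r + total v d r
  total-+ w v zero    d = refl
  total-+ w v (suc r) d = trans (sumTo-cong step d) (sumTo-+ _ _ d)
    where
    rearrange : ∀ a b c x y → (a + b) · c + (x + y) ≡ a · c + x + (b · c + y)
    rearrange = solve-∀
    step : ∀ k → (w k + v k) · p k r + total (λ k → w k + v k) (suc k) r
               ≡ w k · p k r + total w (suc k) r + (v k · p k r + total v (suc k) r)
    step k rewrite total-+ w v r (suc k) = rearrange (w k) (v k) (p k r) _ _

  -- A product rule: cut a path from a + b + 1 into its raised part and its part from b. The steps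
  -- of either part are weighted while the other part is merely counted, and a step k of the raised
  -- part weighs `w (suc (k + b))`.
  total-⊛ : ∀ w r a b → total w (suc (a + b)) r
          ≡ (total (λ k → w (suc (k + b))) a ⊛ paths b) r + (paths a ⊛ total w b) r
  total-⊛ w zero    a b = refl
  total-⊛ w (suc r) a b = begin
    total w (suc (a + b)) (suc r)
      ≡⟨ sumTo-split _ a b ⟩
    total w b (suc r) + sumTo (λ k → w⁺ k · p (suc (k + b)) r + total w (suc (suc k + b)) r) a
      ≡⟨ cong (total w b (suc r) +_) (sumTo-cong step a) ⟩
    total w b (suc r) + sumTo (λ k → ((λ i → w⁺ k · p k i + total w⁺ (suc k) i) ⊛ paths b) r
                                   + (paths (suc k) ⊛ total w b) r) a
      ≡⟨ cong (total w b (suc r) +_) (sumTo-+ _ _ a) ⟩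
    total w b (suc r) + (sumTo (λ k → ((λ i → w⁺ k · p k i + total w⁺ (suc k) i) ⊛ paths b) r) a
                      + sumTo (λ k → (paths (suc k) ⊛ total w b) r) a)
      ≡⟨ cong (total w b (suc r) +_) (cong₂ _+_
           (⊛-sumToˡ (λ k i → w⁺ k · p k i + total w⁺ (suc k) i) (paths b) a r)
           (⊛-sumToˡ (paths ∘ suc) (total w b) a r)) ⟨
    total w b (suc r) + (((total w⁺ a ∘ suc) ⊛ paths b) r + ((paths a ∘ suc) ⊛ total w b) r)
      -- At raised length 0 the first product contributes nothing, as `total w⁺ a 0` is 0, and the
      -- second contributes its factor `paths a 0`, which is 1.
      ≡⟨ rearrange (total w b (suc r)) (((total w⁺ a ∘ suc) ⊛ paths b) r) (((paths a ∘ suc) ⊛ total w b) r) ⟩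
    (total w⁺ a ⊛ paths b) (suc r) + (paths a ⊛ total w b) (suc r)
      ∎
    where
    open ≡-Reasoning
    w⁺ : ℕ → ℕ
    w⁺ k = w (suc (k + b))
    rearrange : ∀ x y z → x + (y + z) ≡ y + (1 · x + z)
    rearrange = solve-∀
    step : ∀ k → w⁺ k · p (suc (k + b)) r + total w (suc (suc k + b)) r
               ≡ ((λ i → w⁺ k · p k i + total w⁺ (suc k) i) ⊛ paths b) r
               + (paths (suc k) ⊛ total w b) r
    step k rewrite p-⊛ k b r | total-⊛ w r (suc k) b
                 | ⊛-distribʳ-+ (paths b) (λ i → w⁺ k · p k i) (total w⁺ (suc k)) r
                 | ⊛-*ˡ (w⁺ k) (p k) (paths b) r = sym (+-assoc (w⁺ k · (p k ⊛ paths b) r) _ _)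

  -- The coefficients of W₀ = t C (2 W₀ + V₀). The first step from label 0 leads to label 1 with
  -- weight 0; splitting label 1 at a = b = 0 yields W₀ once from the unraised part and once more
  -- from the raised part, whose weights are `v k + w k`.
  total-recurrence : ∀ w v → w 0 ≡ 0 → (∀ k → w (suc k) ≡ v k + w k) → ∀ n →
    total w 0 (suc n) ≡ ((λ i → 2 · total w 0 i + total v 0 i) ⊛ paths 0) n
  total-recurrence w v w0≡0 w-suc n = begin
    w 0 · p 0 n + total w 1 n
      ≡⟨ cong (λ x → x · p 0 n + total w 1 n) w0≡0 ⟩
    total w 1 n
      ≡⟨ total-⊛ w n 0 0 ⟩
    (total (λ k → w (suc (k + 0))) 0 ⊛ paths 0) n + (paths 0 ⊛ total w 0) n
      ≡⟨ cong₂ _+_ (⊛-cong shifted (λ _ → refl) n) (⊛-comm (paths 0) (total w 0) n) ⟩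
    ((λ i → total v 0 i + total w 0 i) ⊛ paths 0) n + (total w 0 ⊛ paths 0) n
      ≡⟨ ⊛-distribʳ-+ (paths 0) _ (total w 0) n ⟨
    ((λ i → total v 0 i + total w 0 i + total w 0 i) ⊛ paths 0) n
      ≡⟨ ⊛-cong (λ i → rearrange (total v 0 i) (total w 0 i)) (λ _ → refl) n ⟩
    ((λ i → 2 · total w 0 i + total v 0 i) ⊛ paths 0) n
      ∎
    where
    open ≡-Reasoning
    rearrange : ∀ x y → x + y + y ≡ 2 · y + x
    rearrange = solve-∀
    shifted : total (λ k → w (suc (k + 0))) 0 ≗ λ i → total v 0 i + total w 0 i
    shifted i = trans
      (total-cong (λ k → trans (w-suc (k + 0)) (cong (λ x → v x + w x) (+-identityʳ k))) i 0)
      (total-+ v w i 0)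

-- The Catalan numbers

pascal : ∀ n k → suc n choose suc k ≡ n choose k + n choose suc k
pascal n k = sym (nCk+nC[k+1]≡[n+1]C[k+1] n k)

choose-absorb : ∀ n k → suc k · (suc n choose suc k) ≡ suc n · (n choose k)
choose-absorb n       zero    = trans (*-identityˡ (suc n choose 1)) (trans (nC1≡n (suc n)) (sym (*-identityʳ (suc n))))
choose-absorb zero    (suc k) = *-zeroʳ (suc (suc k))
choose-absorb (suc n) (suc k) = begin
  suc (suc k) · (suc (suc n) choose suc (suc k))
    ≡⟨ cong (suc (suc k) ·_) (pascal (suc n) (suc k)) ⟩
  suc (suc k) · (a + suc n choose suc (suc k))
    ≡⟨ expand (suc k) a _ ⟩
  suc k · a + (a + suc (suc k) · (suc n choose suc (suc k)))
    ≡⟨ cong₂ (λ x y → x + (a + y)) (choose-absorb n k) (choose-absorb n (suc k)) ⟩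
  suc n · (n choose k) + (a + suc n · (n choose suc k))
    ≡⟨ collect (suc n) (n choose k) a _ ⟩
  a + suc n · (n choose k + n choose suc k)
    ≡⟨ cong (λ x → a + suc n · x) (pascal n k) ⟨
  suc (suc n) · a
    ∎
  where
  open ≡-Reasoning
  a : ℕ
  a = suc n choose suc k
  expand : ∀ k a b → suc k · (a + b) ≡ k · a + (a + suc k · b)
  expand = solve-∀
  collect : ∀ n x a y → n · x + (a + n · y) ≡ a + n · (x + y)
  collect = solve-∀

-- Expand both sides of the absorption identity (k + 1) C(n + 1, k + 1) = (n + 1) C(n, k), with n =
-- k + m, and cancel (k + 1) C(n, k).
choose-ratio : ∀ k m → suc k · ((k + m) choose suc k) ≡ m · ((k + m) choose k)
choose-ratio k m = +-cancelˡ-≡ (suc k · (n choose k)) _ _ $ begin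
  suc k · (n choose k) + suc k · (n choose suc k)  ≡⟨ *-distribˡ-+ (suc k) (n choose k) _ ⟨
  suc k · (n choose k + n choose suc k)            ≡⟨ cong (suc k ·_) (pascal n k) ⟨
  suc k · (suc n choose suc k)                     ≡⟨ choose-absorb n k ⟩
  suc n · (n choose k)                             ≡⟨ *-distribʳ-+ (n choose k) (suc k) m ⟩
  suc k · (n choose k) + m · (n choose k)          ∎
  where
  open ≡-Reasoning
  n : ℕ
  n = k + m



infixl 6.5 _choosePred_

-- C(n, k - 1) with the convention C(n, -1) = 0, so that Pascal's rule holds at every k.
_choosePred_ : ℕ → ℕ → ℕ
n choosePred zero  = 0
n choosePred suc k = n choose k

pascal′ : ∀ n k → suc n choose k ≡ n choosePred k + n choose k
pascal′ n zero    = refl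
pascal′ n (suc k) = pascal n k

-- The ballot number formula C(2r + d, r) - C(2r + d, r - 1), written additively. Splitting off the
-- last child reduces label d + 1 to label d with the same length and label d + 2 with one step
-- fewer; Pascal's rule does the same to the binomials.
paths-choose : ∀ r d {n} → n ≡ r + r + d → paths d r + n choosePred r ≡ n choose r
paths-choose zero    d       refl = refl
paths-choose (suc r) zero    refl rewrite +-suc r r | +-identityʳ (r + r) = begin
  paths 1 r + suc n choose r                       ≡⟨ cong (paths 1 r +_) (pascal′ n r) ⟩
  paths 1 r + (n choosePred r + n choose r)        ≡⟨ +-assoc (paths 1 r) _ _ ⟨
  paths 1 r + n choosePred r + n choose r          ≡⟨ cong (_+ n choose r) (paths-choose r 1 (sym (+-comm (r + r) 1))) ⟩
  -- Row 2r + 1 of Pascal's triangle is symmetric: C(2r + 1, r) = C(2r + 1, r + 1).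
  n choose r + n choose r                          ≡⟨ cong (λ k → n choose r + n choose k) (m+n∸m≡n (suc r) r) ⟨
  n choose r + n choose (n ∸ suc r)                ≡⟨ cong (n choose r +_) (nCk≡nC[n∸k] (m≤m+n (suc r) r)) ⟨
  n choose r + n choose suc r                      ≡⟨ pascal n r ⟨
  suc n choose suc r                               ∎
  where
  open ≡-Reasoning
  n : ℕ
  n = suc (r + r)
paths-choose (suc r) (suc d) {suc n} eq = begin
  paths d (suc r) + paths (suc (suc d)) r + suc n choose r
    ≡⟨ cong (paths d (suc r) + paths (suc (suc d)) r +_) (pascal′ n r) ⟩
  paths d (suc r) + paths (suc (suc d)) r + (n choosePred r + n choose r)
    ≡⟨ rearrange (paths d (suc r)) (paths (suc (suc d)) r) _ _ ⟩
  paths (suc (suc d)) r + n choosePred r + (paths d (suc r) + n choose r)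
    ≡⟨ cong₂ _+_ (paths-choose r (suc (suc d)) (trans n≡ (shift r d))) (paths-choose (suc r) d n≡) ⟩
  n choose r + n choose suc r
    ≡⟨ pascal n r ⟨
  suc n choose suc r
    ∎
  where
  open ≡-Reasoning
  n≡ : n ≡ suc r + suc r + d
  n≡ = suc-injective (trans eq (+-suc (suc r + suc r) d))
  rearrange : ∀ a b c e → a + b + (c + e) ≡ b + c + (a + e)
  rearrange = solve-∀
  shift : ∀ r d → suc r + suc r + d ≡ r + r + suc (suc d)
  shift = solve-∀

-- Multiply the ballot formula at d = 0 by n + 1 and use n C(2n, n) = (n + 1) C(2n, n - 1). That
-- product is added to both sides and cancelled, to avoid subtraction.
catalan : ∀ n → suc n · paths 0 n ≡ (2 · n) choose n
catalan zero      = refl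
catalan n@(suc r) = +-cancelʳ-≡ (n · (2 · n choose n)) _ _ $ begin
  suc n · paths 0 n + n · (2 · n choose n)
    ≡⟨ cong (suc n · paths 0 n +_) ratio ⟩
  suc n · paths 0 n + suc n · (2 · n choosePred n)
    ≡⟨ *-distribˡ-+ (suc n) (paths 0 n) _ ⟨
  suc n · (paths 0 n + 2 · n choosePred n)
    ≡⟨ cong (suc n ·_) (paths-choose n 0 (double n)) ⟩
  suc n · (2 · n choose n)
    ∎
  where
  open ≡-Reasoning
  double : ∀ n → 2 · n ≡ n + n + 0
  double = solve-∀
  2n≡ : ∀ r → r + suc (suc r) ≡ 2 · suc r
  2n≡ = solve-∀
  ratio : n · (2 · n choose n) ≡ suc n · (2 · n choosePred n)
  ratio = subst (λ m → n · (m choose n) ≡ suc n · (m choose r)) (2n≡ r) (choose-ratio r (suc (suc r)))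

-- Power series with natural number coefficients

module ≃-Reasoning = SetoidReasoning ℚᵘ.≃-setoid

fromℕ : ℕ → ℚ
fromℕ n = ℤ.+ n ℚ./ 1

-- `ℚ._/_` reduces fractions by a gcd and so does not compute on variables. Identities are therefore
-- checked between unnormalised fractions and transported along `toℚᵘ`.
toℚᵘ-/ : ∀ i n → toℚᵘ (i ℚ./ suc n) ℚᵘ.≃ mkℚᵘ i n
toℚᵘ-/ i n = ℚ.toℚᵘ-fromℚᵘ (mkℚᵘ i n)

fromℕ-+ : ∀ m n → fromℕ (m + n) ≡ fromℕ m ℚ.+ fromℕ n
fromℕ-+ m n = ℚ.toℚᵘ-injective $ begin
  toℚᵘ (fromℕ (m + n))                 ≈⟨ toℚᵘ-/ (ℤ.+ (m + n)) 0 ⟩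
  mkℚᵘ (ℤ.+ (m + n)) 0                   ≈⟨ *≡* (cong (ℤ._* ℤ.+ 1) (sym (cong₂ ℤ._+_ (ℤ.*-identityʳ (ℤ.+ m)) (ℤ.*-identityʳ (ℤ.+ n))))) ⟩
  mkℚᵘ (ℤ.+ m) 0 ℚᵘ.+ mkℚᵘ (ℤ.+ n) 0       ≈⟨ ℚᵘ.+-cong (toℚᵘ-/ (ℤ.+ m) 0) (toℚᵘ-/ (ℤ.+ n) 0) ⟨
  toℚᵘ (fromℕ m) ℚᵘ.+ toℚᵘ (fromℕ n)   ≈⟨ ℚ.toℚᵘ-homo-+ (fromℕ m) (fromℕ n) ⟨
  toℚᵘ (fromℕ m ℚ.+ fromℕ n)           ∎
  where open ≃-Reasoning

fromℕ-· : ∀ m n → fromℕ (m · n) ≡ fromℕ m ℚ.* fromℕ n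
fromℕ-· m n = ℚ.toℚᵘ-injective $ begin
  toℚᵘ (fromℕ (m · n))                 ≈⟨ toℚᵘ-/ (ℤ.+ (m · n)) 0 ⟩
  mkℚᵘ (ℤ.+ (m · n)) 0                   ≈⟨ *≡* (cong (ℤ._* ℤ.+ 1) (ℤ.pos-* m n)) ⟩
  mkℚᵘ (ℤ.+ m) 0 ℚᵘ.* mkℚᵘ (ℤ.+ n) 0       ≈⟨ ℚᵘ.*-cong (toℚᵘ-/ (ℤ.+ m) 0) (toℚᵘ-/ (ℤ.+ n) 0) ⟨
  toℚᵘ (fromℕ m) ℚᵘ.* toℚᵘ (fromℕ n)   ≈⟨ ℚ.toℚᵘ-homo-* (fromℕ m) (fromℕ n) ⟨
  toℚᵘ (fromℕ m ℚ.* fromℕ n)           ∎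
  where open ≃-Reasoning

1/n*n≡1 : ∀ n → (ℤ.+ 1 ℚ./ suc n) ℚ.* fromℕ (suc n) ≡ 1ℚ
1/n*n≡1 n = ℚ.toℚᵘ-injective $ begin
  toℚᵘ ((ℤ.+ 1 ℚ./ suc n) ℚ.* fromℕ (suc n))           ≈⟨ ℚ.toℚᵘ-homo-* (ℤ.+ 1 ℚ./ suc n) (fromℕ (suc n)) ⟩
  toℚᵘ (ℤ.+ 1 ℚ./ suc n) ℚᵘ.* toℚᵘ (fromℕ (suc n))     ≈⟨ ℚᵘ.*-cong (toℚᵘ-/ (ℤ.+ 1) n) (toℚᵘ-/ (ℤ.+ suc n) 0) ⟩
  mkℚᵘ (ℤ.+ 1) n ℚᵘ.* mkℚᵘ (ℤ.+ suc n) 0                 ≈⟨ *≡* (cong ℤ.+_ (lemma n)) ⟩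
  ℚᵘ.1ℚᵘ                                             ∎
  where
  open ≃-Reasoning
  lemma : ∀ n → 1 · suc n · 1 ≡ 1 · (suc n · 1)
  lemma = solve-∀

C≡paths : C ≗ fromℕ ∘ paths 0
C≡paths n = begin
  c ℚ.* fromℕ ((2 · n) choose n)               ≡⟨ cong (λ m → c ℚ.* fromℕ m) (catalan n) ⟨
  c ℚ.* fromℕ (suc n · paths 0 n)              ≡⟨ cong (c ℚ.*_) (fromℕ-· (suc n) (paths 0 n)) ⟩
  c ℚ.* (fromℕ (suc n) ℚ.* fromℕ (paths 0 n))  ≡⟨ ℚ.*-assoc c (fromℕ (suc n)) (fromℕ (paths 0 n)) ⟨
  c ℚ.* fromℕ (suc n) ℚ.* fromℕ (paths 0 n)    ≡⟨ cong (ℚ._* fromℕ (paths 0 n)) (1/n*n≡1 n) ⟩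
  1ℚ ℚ.* fromℕ (paths 0 n)                     ≡⟨ ℚ.*-identityˡ (fromℕ (paths 0 n)) ⟩
  fromℕ (paths 0 n)                            ∎
  where
  open ≡-Reasoning
  c : ℚ
  c = ℤ.+ 1 ℚ./ suc n

-- Multiplication and division of power series

*-cong : ∀ {f f′ g g′} → f ≗ f′ → g ≗ g′ → f * g ≗ f′ * g′
*-cong f≗ g≗ zero    = cong (ℚ._+ 0ℚ) (cong₂ ℚ._*_ (f≗ 0) (g≗ 0))
*-cong f≗ g≗ (suc n) =
  cong₂ ℚ._+_ (cong₂ ℚ._*_ (f≗ 0) (g≗ (suc n))) (*-cong (f≗ ∘ suc) g≗ n)

*-last : ∀ f g n → (f * g) (suc n) ≡ f (suc n) ℚ.* g 0 ℚ.+ (f * (g ∘ suc)) n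
*-last f g zero    = begin
  f 0 ℚ.* g 1 ℚ.+ (f 1 ℚ.* g 0 ℚ.+ 0ℚ)    ≡⟨ cong (f 0 ℚ.* g 1 ℚ.+_) (ℚ.+-identityʳ (f 1 ℚ.* g 0)) ⟩
  f 0 ℚ.* g 1 ℚ.+ f 1 ℚ.* g 0             ≡⟨ ℚ.+-comm (f 0 ℚ.* g 1) (f 1 ℚ.* g 0) ⟩
  f 1 ℚ.* g 0 ℚ.+ f 0 ℚ.* g 1             ≡⟨ cong (f 1 ℚ.* g 0 ℚ.+_) (ℚ.+-identityʳ (f 0 ℚ.* g 1)) ⟨
  f 1 ℚ.* g 0 ℚ.+ (f 0 ℚ.* g 1 ℚ.+ 0ℚ)    ∎
  where open ≡-Reasoning
*-last f g (suc n) = begin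
  a ℚ.+ ((f ∘ suc) * g) (suc n)  ≡⟨ cong (a ℚ.+_) (*-last (f ∘ suc) g n) ⟩
  a ℚ.+ (b ℚ.+ c)                ≡⟨ ℚ.+-assoc a b c ⟨
  a ℚ.+ b ℚ.+ c                  ≡⟨ cong (ℚ._+ c) (ℚ.+-comm a b) ⟩
  b ℚ.+ a ℚ.+ c                  ≡⟨ ℚ.+-assoc b a c ⟩
  b ℚ.+ (a ℚ.+ c)                ∎
  where
  open ≡-Reasoning
  a b c : ℚ
  a = f 0 ℚ.* g (suc (suc n))
  b = f (suc (suc n)) ℚ.* g 0
  c = ((f ∘ suc) * (g ∘ suc)) n

*-negʳ : ∀ f g n → (f * (ℚ.-_ ∘ g)) n ≡ ℚ.- (f * g) n
*-negʳ f g zero    = begin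
  f 0 ℚ.* ℚ.- g 0 ℚ.+ 0ℚ      ≡⟨ ℚ.+-identityʳ _ ⟩
  f 0 ℚ.* ℚ.- g 0             ≡⟨ ℚ.neg-distribʳ-* (f 0) (g 0) ⟨
  ℚ.- (f 0 ℚ.* g 0)           ≡⟨ cong ℚ.-_ (ℚ.+-identityʳ (f 0 ℚ.* g 0)) ⟨
  ℚ.- (f 0 ℚ.* g 0 ℚ.+ 0ℚ)    ∎
  where open ≡-Reasoning
*-negʳ f g (suc n) = trans
  (cong₂ ℚ._+_ (sym (ℚ.neg-distribʳ-* (f 0) (g (suc n)))) (*-negʳ (f ∘ suc) g n))
  (sym (ℚ.neg-distrib-+ (f 0 ℚ.* g (suc n)) _))

constant-* : ∀ q f n → (constant q * f) n ≡ q ℚ.* f n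
constant-* q f zero    = ℚ.+-identityʳ (q ℚ.* f 0)
constant-* q f (suc n) = begin
  q ℚ.* f (suc n) ℚ.+ ((λ _ → 0ℚ) * f) n   ≡⟨ cong (q ℚ.* f (suc n) ℚ.+_) (zero-* n) ⟩
  q ℚ.* f (suc n) ℚ.+ 0ℚ                   ≡⟨ ℚ.+-identityʳ _ ⟩
  q ℚ.* f (suc n)                          ∎
  where
  open ≡-Reasoning
  zero-* : ∀ n → ((λ _ → 0ℚ) * f) n ≡ 0ℚ
  zero-* zero    = trans (ℚ.+-identityʳ (0ℚ ℚ.* f 0)) (ℚ.*-zeroˡ (f 0))
  zero-* (suc n) = cong₂ ℚ._+_ (ℚ.*-zeroˡ (f (suc n))) (zero-* n)

-- The hypotheses say that `f` is q t; this covers both `t` and `two * t`.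
shift-* : ∀ f q → f 0 ≡ 0ℚ → f ∘ suc ≗ constant q → ∀ g n → (f * g) (suc n) ≡ q ℚ.* g n
shift-* f q f0≡0 f-suc g n = begin
  f 0 ℚ.* g (suc n) ℚ.+ ((f ∘ suc) * g) n   ≡⟨ cong₂ ℚ._+_ (cong (ℚ._* g (suc n)) f0≡0) (*-cong {g = g} f-suc (λ _ → refl) n) ⟩
  0ℚ ℚ.* g (suc n) ℚ.+ (constant q * g) n   ≡⟨ cong₂ ℚ._+_ (ℚ.*-zeroˡ (g (suc n))) (constant-* q g n) ⟩
  0ℚ ℚ.+ q ℚ.* g n                          ≡⟨ ℚ.+-identityˡ _ ⟩
  q ℚ.* g n                                 ∎
  where open ≡-Reasoning

t-*-suc : ∀ f n → (t * f) (suc n) ≡ f n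
t-*-suc f n = trans (shift-* t 1ℚ refl (λ { zero → refl ; (suc _) → refl }) f n) (ℚ.*-identityˡ (f n))

two-t-C-suc : ∀ n → (two * t * C) (suc n) ≡ fromℕ 2 ℚ.* C n
two-t-C-suc = shift-* (two * t) (fromℕ 2) refl
  (λ n → trans (constant-* (fromℕ 2) t (suc n)) (2*t n)) C
  where
  2*t : ∀ n → fromℕ 2 ℚ.* t (suc n) ≡ two n
  2*t zero    = refl
  2*t (suc _) = refl

fromℕ-⊛ : ∀ f g → (fromℕ ∘ f) * (fromℕ ∘ g) ≗ fromℕ ∘ (f ⊛ g)
fromℕ-⊛ f g zero    = trans (ℚ.+-identityʳ _) (sym (fromℕ-· (f 0) (g 0)))
fromℕ-⊛ f g (suc n) = trans
  (cong₂ ℚ._+_ (sym (fromℕ-· (f 0) (g (suc n)))) (fromℕ-⊛ (f ∘ suc) g n))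
  (sym (fromℕ-+ (f 0 · g (suc n)) _))

-- Turns a quotient into a product identity. The constant coefficients force h₀ = f₀ / g₀, and then
-- `h ∘ suc` times `g` is the remainder on which the long division continues.
/-unique : ∀ f g h .{{_ : ℚ.NonZero (g 0)}} → h * g ≗ f → h ≗ f / g
/-unique f g h h*g≗f = go
  where
  open ≡-Reasoning
  h0≡ : h 0 ≡ f 0 ℚ.÷ g 0
  h0≡ = begin
    h 0                                    ≡⟨ ℚ.*-identityʳ (h 0) ⟨
    h 0 ℚ.* 1ℚ                             ≡⟨ cong (h 0 ℚ.*_) (ℚ.*-inverseʳ (g 0)) ⟨
    h 0 ℚ.* (g 0 ℚ.* (ℚ.1/ g 0))           ≡⟨ ℚ.*-assoc (h 0) (g 0) (ℚ.1/ g 0) ⟨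
    h 0 ℚ.* g 0 ℚ.* (ℚ.1/ g 0)             ≡⟨ cong (ℚ._* (ℚ.1/ g 0)) (trans (sym (ℚ.+-identityʳ (h 0 ℚ.* g 0))) (h*g≗f 0)) ⟩
    f 0 ℚ.÷ g 0                            ∎
  cancel : ∀ a b c → a ℚ.+ b ≡ c → b ≡ c ℚ.- a
  cancel a b c eq = begin
    b                  ≡⟨ ℚ.+-identityʳ b ⟨
    b ℚ.+ 0ℚ           ≡⟨ cong (b ℚ.+_) (ℚ.+-inverseʳ a) ⟨
    b ℚ.+ (a ℚ.- a)    ≡⟨ ℚ.+-assoc b a (ℚ.- a) ⟨
    b ℚ.+ a ℚ.- a      ≡⟨ cong (ℚ._- a) (trans (ℚ.+-comm b a) eq) ⟩
    c ℚ.- a            ∎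
  go : h ≗ f / g
  go zero    = h0≡
  go (suc n) = /-unique _ g (h ∘ suc) (λ k → trans
    (cancel (h 0 ℚ.* g (suc k)) _ _ (h*g≗f (suc k)))
    (cong (λ q → f (suc k) ℚ.- q ℚ.* g (suc k)) h0≡)) n

-- `d` and `e` stand for 1 - 2 t C and t C g and enter only through their coefficients. The
-- recurrence splits w (n + 1) into a coefficient of C g and one of 2 C f; multiplying f by -2 t C
-- removes exactly the latter.
recurrence⇒product : ∀ {f g d e : Series} (w v : ℕ → ℕ) →
  f ≗ fromℕ ∘ w → g ≗ fromℕ ∘ v → w 0 ≡ 0 →
  (∀ n → w (suc n) ≡ ((λ i → 2 · w i + v i) ⊛ paths 0) n) →
  d 0 ≡ 1ℚ → (∀ n → d (suc n) ≡ ℚ.- fromℕ (2 · paths 0 n)) →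
  e 0 ≡ 0ℚ → (∀ n → e (suc n) ≡ (C * g) n) →
  f * d ≗ e
recurrence⇒product {f} {g} {d} {e} w v f≗w g≗v w0≡0 w-suc d0≡1 d-suc e0≡0 e-suc = go
  where
  open ≡-Reasoning
  c 2c : ℕ → ℕ
  c    = paths 0
  2c n = 2 · c n
  w-suc′ : ∀ n → w (suc n) ≡ (c ⊛ v) n + (w ⊛ 2c) n
  w-suc′ n = begin
    w (suc n)                              ≡⟨ w-suc n ⟩
    ((λ i → 2 · w i + v i) ⊛ c) n          ≡⟨ ⊛-distribʳ-+ c (λ i → 2 · w i) v n ⟩
    ((λ i → 2 · w i) ⊛ c) n + (v ⊛ c) n    ≡⟨ +-comm _ ((v ⊛ c) n) ⟩
    (v ⊛ c) n + ((λ i → 2 · w i) ⊛ c) n    ≡⟨ cong₂ _+_ (⊛-comm v c n) (⊛-*ˡ 2 w c n) ⟩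
    (c ⊛ v) n + 2 · (w ⊛ c) n              ≡⟨ cong (λ x → (c ⊛ v) n + 2 · x) (⊛-comm w c n) ⟩
    (c ⊛ v) n + 2 · (c ⊛ w) n              ≡⟨ cong ((c ⊛ v) n +_) (⊛-*ˡ 2 c w n) ⟨
    (c ⊛ v) n + (2c ⊛ w) n                 ≡⟨ cong ((c ⊛ v) n +_) (⊛-comm 2c w n) ⟩
    (c ⊛ v) n + (w ⊛ 2c) n                 ∎
  go : f * d ≗ e
  go zero    = begin
    f 0 ℚ.* d 0 ℚ.+ 0ℚ    ≡⟨ ℚ.+-identityʳ (f 0 ℚ.* d 0) ⟩
    f 0 ℚ.* d 0           ≡⟨ cong (ℚ._* d 0) (trans (f≗w 0) (cong fromℕ w0≡0)) ⟩
    0ℚ ℚ.* d 0            ≡⟨ ℚ.*-zeroˡ (d 0) ⟩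
    0ℚ                    ≡⟨ e0≡0 ⟨
    e 0                   ∎
  go (suc n) = begin
    (f * d) (suc n)
      ≡⟨ *-last f d n ⟩
    f (suc n) ℚ.* d 0 ℚ.+ (f * (d ∘ suc)) n
      ≡⟨ cong₂ ℚ._+_ (trans (cong (f (suc n) ℚ.*_) d0≡1) (ℚ.*-identityʳ (f (suc n)))) (*-cong f≗w d-suc n) ⟩
    f (suc n) ℚ.+ ((fromℕ ∘ w) * (ℚ.-_ ∘ (fromℕ ∘ 2c))) n
      ≡⟨ cong₂ ℚ._+_ (trans (f≗w (suc n)) (cong fromℕ (w-suc′ n))) (*-negʳ (fromℕ ∘ w) (fromℕ ∘ 2c) n) ⟩
    fromℕ ((c ⊛ v) n + x) ℚ.- ((fromℕ ∘ w) * (fromℕ ∘ 2c)) n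
      ≡⟨ cong₂ ℚ._-_ (fromℕ-+ ((c ⊛ v) n) x) (fromℕ-⊛ w 2c n) ⟩
    fromℕ ((c ⊛ v) n) ℚ.+ fromℕ x ℚ.- fromℕ x
      ≡⟨ ℚ.+-assoc (fromℕ ((c ⊛ v) n)) (fromℕ x) (ℚ.- fromℕ x) ⟩
    fromℕ ((c ⊛ v) n) ℚ.+ (fromℕ x ℚ.- fromℕ x)
      ≡⟨ cong (fromℕ ((c ⊛ v) n) ℚ.+_) (ℚ.+-inverseʳ (fromℕ x)) ⟩
    fromℕ ((c ⊛ v) n) ℚ.+ 0ℚ
      ≡⟨ ℚ.+-identityʳ (fromℕ ((c ⊛ v) n)) ⟩
    fromℕ ((c ⊛ v) n)
      ≡⟨ fromℕ-⊛ c v n ⟨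
    ((fromℕ ∘ c) * (fromℕ ∘ v)) n
      ≡⟨ *-cong C≡paths g≗v n ⟨
    (C * g) n
      ≡⟨ e-suc n ⟨
    e (suc n)
      ∎
    where
    x : ℕ
    x = (w ⊛ 2c) n

one-2tC-suc : ∀ n → (one - two * t * C) (suc n) ≡ ℚ.- fromℕ (2 · paths 0 n)
one-2tC-suc n = trans (ℚ.+-identityˡ (ℚ.- (two * t * C) (suc n))) (cong ℚ.-_ (begin
  (two * t * C) (suc n)            ≡⟨ two-t-C-suc n ⟩
  fromℕ 2 ℚ.* C n                  ≡⟨ cong (fromℕ 2 ℚ.*_) (C≡paths n) ⟩
  fromℕ 2 ℚ.* fromℕ (paths 0 n)    ≡⟨ fromℕ-· 2 (paths 0 n) ⟨
  fromℕ (2 · paths 0 n)            ∎))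
  where open ≡-Reasoning

tC*-zero : ∀ g → (t * C * g) 0 ≡ 0ℚ
tC*-zero g = trans (ℚ.+-identityʳ ((t * C) 0 ℚ.* g 0)) (ℚ.*-zeroˡ (g 0))

tC*-suc : ∀ g n → (t * C * g) (suc n) ≡ (C * g) n
tC*-suc g n = begin
  (t * C) 0 ℚ.* g (suc n) ℚ.+ (((t * C) ∘ suc) * g) n    ≡⟨ cong₂ ℚ._+_ (ℚ.*-zeroˡ (g (suc n))) (*-cong {g = g} (t-*-suc C) (λ _ → refl) n) ⟩
  0ℚ ℚ.+ (C * g) n                                       ≡⟨ ℚ.+-identityˡ ((C * g) n) ⟩
  (C * g) n                                              ∎
  where open ≡-Reasoning

recurrence⇒quotient : ∀ {f g : Series} (w v : ℕ → ℕ) →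
  f ≗ fromℕ ∘ w → g ≗ fromℕ ∘ v → w 0 ≡ 0 →
  (∀ n → w (suc n) ≡ ((λ i → 2 · w i + v i) ⊛ paths 0) n) →
  f ≗ t * C * g / (one - two * t * C)
recurrence⇒quotient {f} {g} w v f≗w g≗v w0≡0 w-suc =
  -- The constant coefficient of the denominator evaluates to 1, so `refl` proves `d 0 ≡ 1ℚ`.
  /-unique (t * C * g) (one - two * t * C) f
    (recurrence⇒product w v f≗w g≗v w0≡0 w-suc refl one-2tC-suc (tC*-zero g) (tC*-suc g))

-- Occurrences in avoiding permutations

module _ {A B : Set} {P : B → Set} {Q : A → Set} (P? : Decidable P) (Q? : Decidable Q) (f : A → B) where

  filter-map : ∀ {xs} → All (λ x → (P (f x) → Q x) × (Q x → P (f x))) xs →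
               filter P? (map f xs) ≡ map f (filter Q? xs)
  filter-map []                       = refl
  filter-map {x ∷ xs} ((to , from) ∷ eqs) with P? (f x) | Q? x
  ... | yes _ | yes _ = cong (f x ∷_) (filter-map eqs)
  ... | no _  | no _  = filter-map eqs
  ... | yes p | no ¬q = contradiction (to p) ¬q
  ... | no ¬p | yes q = contradiction (from q) ¬p

module _ {A : Set} {P Q : A → Set} (P? : Decidable P) (Q? : Decidable Q) where

  filter-× : ∀ xs → filter (λ x → P? x ×-dec Q? x) xs ≡ filter Q? (filter P? xs)
  filter-× []       = refl
  filter-× (x ∷ xs) with P? x
  ... | no _  = filter-× xs
  ... | yes _ with Q? x
  ...   | yes _ = cong (x ∷_) (filter-× xs)
  ...   | no _  = filter-× xs

  length-filter-mono : (∀ {x} → P x → Q x) → ∀ xs → length (filter P? xs) ≤ length (filter Q? xs)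
  length-filter-mono P⊆Q []       = z≤n
  length-filter-mono P⊆Q (x ∷ xs) with P? x | Q? x
  ... | yes _ | yes _ = s≤s (length-filter-mono P⊆Q xs)
  ... | no _  | yes _ = m≤n⇒m≤1+n (length-filter-mono P⊆Q xs)
  ... | no _  | no _  = length-filter-mono P⊆Q xs
  ... | yes p | no ¬q = contradiction (P⊆Q p) ¬q

module _ {A : Set} {P : A → Set} (P? : Decidable P) where

  length-filter≡0⇒none : ∀ xs → length (filter P? xs) ≡ 0 → All (¬_ ∘ P) xs
  length-filter≡0⇒none []       _  = []
  length-filter≡0⇒none (x ∷ xs) eq with P? x
  ... | no ¬p = ¬p ∷ length-filter≡0⇒none xs eq

-- Patterns and the order of letters

rank : Word → ℕ → ℕ
rank w x = length (filter (_≤? x) w)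

rank-mono : ∀ w {x y} → x ≤ y → rank w x ≤ rank w y
rank-mono w {x} {y} x≤y = length-filter-mono (_≤? x) (_≤? y) (λ z≤x → ≤-trans z≤x x≤y) w

rank-cancel-< : ∀ w {x y} → rank w x < rank w y → x < y
rank-cancel-< w rx<ry = ≰⇒> λ y≤x → <⇒≱ rx<ry (rank-mono w y≤x)

red-minimum : ∀ {x w} → All (x <_) w → red (x ∷ w) ≡ 1 ∷ map suc (red w)
red-minimum {x} {w} x<w = cong₂ _∷_ head (trans tail (map-∘ w))
  where
  head : rank (x ∷ w) x ≡ 1
  head = trans (cong length (filter-accept (_≤? x) {x} {w} ≤-refl))
               (cong (suc ∘ length) (filter-none (_≤? x) (All.map <⇒≱ x<w)))
  tail : map (rank (x ∷ w)) w ≡ map (suc ∘ rank w) w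
  tail = map-cong-local (All.map (λ {y} x<y → cong length (filter-accept (_≤? y) {x} {w} (<⇒≤ x<y))) x<w)

red-maximum : ∀ {x w} → All (x >_) w → red (x ∷ w) ≡ suc (length w) ∷ red w
red-maximum {x} {w} x>w = cong₂ _∷_ head tail
  where
  head : rank (x ∷ w) x ≡ suc (length w)
  head = cong length (filter-all (_≤? x) {x ∷ w} (≤-refl ∷ All.map <⇒≤ x>w))
  tail : map (rank (x ∷ w)) w ≡ map (rank w) w
  tail = map-cong-local (All.map (λ {y} x>y → cong length (filter-reject (_≤? y) {x} {w} (<⇒≱ x>y))) x>w)

-- The direction in which the larger letters to the right of a letter are sorted. The counted
-- patterns are `pat s j` and the avoided one is `pat (opposite s) 2`, which is 132 for `up` and 123
-- for `down`; this treats F and G at once.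
data Direction : Set where
  up down : Direction

opposite : Direction → Direction
opposite up   = down
opposite down = up

Ordered : Direction → ℕ → ℕ → Set
Ordered up   = _<_
Ordered down = _>_

Sorted : Direction → Word → Set
Sorted s = AllPairs (Ordered s)

sorted? : ∀ s → Decidable (Sorted s)
sorted? up   = allPairs? _<?_
sorted? down = allPairs? _>?_

Ordered-asym : ∀ s {x y} → Ordered s x y → ¬ Ordered (opposite s) x y
Ordered-asym up   = <-asym
Ordered-asym down = <-asym

Ordered-total : ∀ s {x y} → x ≢ y → ¬ Ordered (opposite s) x y → Ordered s x y
Ordered-total up   x≢y x≯y = ≤∧≢⇒< (≮⇒≥ x≯y) x≢y
Ordered-total down x≢y x≮y = ≤∧≢⇒< (≮⇒≥ x≮y) (x≢y ∘ sym)

Ordered-reflect : ∀ s {f : ℕ → ℕ} → (∀ {x y} → f x < f y → x < y) →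
                  ∀ {x y} → Ordered s (f x) (f y) → Ordered s x y
Ordered-reflect up   f⁻ = f⁻
Ordered-reflect down f⁻ = f⁻

Ordered-preserve : ∀ s {f : ℕ → ℕ} → (∀ {x y} → x < y → f x < f y) →
                   ∀ {x y} → Ordered s x y → Ordered s (f x) (f y)
Ordered-preserve up   f⁺ = f⁺
Ordered-preserve down f⁺ = f⁺

-- The pattern with j + 1 letters whose first letter is its minimum and whose
-- other letters are sorted in direction s.
pat : Direction → ℕ → Word
pat up   j = increasing (suc j)
pat down j = one-then-decreasing (suc j)

length-pat : ∀ s j → length (pat s j) ≡ suc j
length-pat up   j = length-applyUpTo suc (suc j)
length-pat down j = cong suc (length-applyDownFrom (2 +_) j)

red-increasing : ∀ {w} → Sorted up w → red w ≡ applyUpTo suc (length w)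
red-increasing []              = refl
red-increasing {x ∷ w} (x<w ∷ w↑) = begin
  red (x ∷ w)                                ≡⟨ red-minimum x<w ⟩
  1 ∷ map suc (red w)                        ≡⟨ cong (λ v → 1 ∷ map suc v) (red-increasing w↑) ⟩
  1 ∷ map suc (applyUpTo suc (length w))     ≡⟨ cong (1 ∷_) (map-applyUpTo suc suc (length w)) ⟩
  applyUpTo suc (suc (length w))             ∎
  where open ≡-Reasoning

red-decreasing : ∀ {w} → Sorted down w → red w ≡ applyDownFrom suc (length w)
red-decreasing []                 = refl
red-decreasing {x ∷ w} (x>w ∷ w↓) =
  trans (red-maximum x>w) (cong (suc (length w) ∷_) (red-decreasing w↓))

red≡pat⁺ : ∀ s {x w} → All (x <_) w → Sorted s w → red (x ∷ w) ≡ pat s (length w)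
red≡pat⁺ up       x<w w↑ = red-increasing (x<w ∷ w↑)
red≡pat⁺ down {x} {w} x<w w↓ = begin
  red (x ∷ w)                                   ≡⟨ red-minimum x<w ⟩
  1 ∷ map suc (red w)                           ≡⟨ cong (λ v → 1 ∷ map suc v) (red-decreasing w↓) ⟩
  1 ∷ map suc (applyDownFrom suc (length w))    ≡⟨ cong (1 ∷_) (map-applyDownFrom suc suc (length w)) ⟩
  pat down (length w)                           ∎
  where open ≡-Reasoning

pat-shape : ∀ s j → ∃ λ w → pat s j ≡ 1 ∷ w × All (1 <_) w × Sorted s w
pat-shape up   j = applyUpTo (2 +_) j , refl , All.applyUpTo⁺₂ (2 +_) j (λ _ → s≤s (s≤s z≤n))
                 , AllPairs.applyUpTo⁺₁ (2 +_) j (λ i<k _ → +-monoʳ-< 2 i<k)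
pat-shape down j = applyDownFrom (2 +_) j , refl , All.applyDownFrom⁺₂ (2 +_) j (λ _ → s≤s (s≤s z≤n))
                 , AllPairs.applyDownFrom⁺₁ (2 +_) j (λ k<i _ → +-monoʳ-< 2 k<i)

-- `red` applies `rank (x ∷ w)` to every letter, and ranks reflect the strict order. The
-- inequalities between the letters of the pattern therefore pull back to x and w.
red≡pat⁻ : ∀ s j {x w} → red (x ∷ w) ≡ pat s j → All (x <_) w × Sorted s w
red≡pat⁻ s j {x} {w} eq with pat-shape s j
... | v , pat≡ , 1<v , sorted with ∷-injective (trans eq pat≡)
...   | rank≡1 , refl =
      All.map (λ {y} 1<ry → rank-cancel-< (x ∷ w) (subst (_< rank (x ∷ w) y) (sym rank≡1) 1<ry)) (All.map⁻ 1<v)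
    , AllPairs.map (Ordered-reflect s {rank (x ∷ w)} (rank-cancel-< (x ∷ w))) (AllPairs.map⁻ sorted)

-- Subwords and occurrences

length-subwords : ∀ j σ → length (subwords j σ) ≡ length σ choose j
length-subwords zero    σ       = refl
length-subwords (suc j) []      = refl
length-subwords (suc j) (x ∷ σ) = begin
  length (map (x ∷_) (subwords j σ) ++ subwords (suc j) σ)           ≡⟨ length-++ (map (x ∷_) (subwords j σ)) ⟩
  length (map (x ∷_) (subwords j σ)) + length (subwords (suc j) σ)   ≡⟨ cong₂ _+_ (length-map (x ∷_) (subwords j σ)) (length-subwords (suc j) σ) ⟩
  length (subwords j σ) + length σ choose suc j                      ≡⟨ cong (_+ length σ choose suc j) (length-subwords j σ) ⟩
  length σ choose j + length σ choose suc j                          ≡⟨ pascal (length σ) j ⟨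
  suc (length σ) choose suc j                                        ∎
  where open ≡-Reasoning

subwords-length : ∀ j σ → All (λ w → length w ≡ j) (subwords j σ)
subwords-length zero    σ       = refl ∷ []
subwords-length (suc j) []      = []
subwords-length (suc j) (x ∷ σ) =
  All.++⁺ (All.map⁺ (All.map (cong suc) (subwords-length j σ))) (subwords-length (suc j) σ)

subwords-All : ∀ {P : ℕ → Set} j {σ} → All P σ → All (All P) (subwords j σ)
subwords-All zero    _        = [] ∷ []
subwords-All (suc j) []       = []
subwords-All (suc j) (p ∷ ps) =
  All.++⁺ (All.map⁺ (All.map (p ∷_) (subwords-All j ps))) (subwords-All (suc j) ps)

subwords-AllPairs : ∀ {R : ℕ → ℕ → Set} j {σ} → AllPairs R σ → All (AllPairs R) (subwords j σ)
subwords-AllPairs zero    _        = [] ∷ []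
subwords-AllPairs (suc j) []       = []
subwords-AllPairs (suc j) (r ∷ rs) =
  All.++⁺ (All.map⁺ (All.zipWith (λ { (q , qs) → q ∷ qs }) (subwords-All j r , subwords-AllPairs j rs)))
          (subwords-AllPairs (suc j) rs)

filter-subwords : ∀ {P : ℕ → Set} (P? : Decidable P) j σ →
                  filter (all? P?) (subwords j σ) ≡ subwords j (filter P? σ)
filter-subwords P? zero    σ       = refl
filter-subwords P? (suc j) []      = refl
filter-subwords {P} P? (suc j) (x ∷ σ) = trans
  (filter-++ (all? P?) (map (x ∷_) (subwords j σ)) (subwords (suc j) σ)) rest
  where
  rest : filter (all? P?) (map (x ∷_) (subwords j σ)) ++ filter (all? P?) (subwords (suc j) σ)
       ≡ subwords (suc j) (filter P? (x ∷ σ))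
  rest with P? x
  ... | yes p = cong₂ _++_
    (trans (filter-map (all? P?) (all? P?) (x ∷_) (All.universal (λ _ → All.tail , (p ∷_)) (subwords j σ)))
           (cong (map (x ∷_)) (filter-subwords P? j σ)))
    (filter-subwords P? (suc j) σ)
  ... | no ¬p = cong₂ _++_
    (filter-none (all? P?) (All.map⁺ (All.universal (λ _ → ¬p ∘ All.head) (subwords j σ))))
    (filter-subwords P? (suc j) σ)

above : ℕ → Word → Word
above x = filter (x <?_)

-- An occurrence either avoids the first position or consists of x and a sorted subword of larger
-- letters. The condition that all letters exceed x is absorbed by deleting the smaller letters
-- first, which is `filter-subwords`.
occr-∷ : ∀ s j x σ → occr (pat s j) (x ∷ σ)
       ≡ length (filter (sorted? s) (subwords j (above x σ))) + occr (pat s j) σ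
occr-∷ s j x σ rewrite length-pat s j = begin
  length (filter P? (map (x ∷_) S ++ subwords (suc j) σ))
    ≡⟨ cong length (filter-++ P? (map (x ∷_) S) (subwords (suc j) σ)) ⟩
  length (filter P? (map (x ∷_) S) ++ filter P? (subwords (suc j) σ))
    ≡⟨ length-++ (filter P? (map (x ∷_) S)) ⟩
  length (filter P? (map (x ∷_) S)) + length (filter P? (subwords (suc j) σ))
    ≡⟨ cong (_+ length (filter P? (subwords (suc j) σ))) (begin
         length (filter P? (map (x ∷_) S))
           ≡⟨ cong length (filter-map P? (λ w → all? (x <?_) w ×-dec sorted? s w) (x ∷_) (All.map equiv (subwords-length j σ))) ⟩
         length (map (x ∷_) (filter (λ w → all? (x <?_) w ×-dec sorted? s w) S))
           ≡⟨ length-map (x ∷_) (filter (λ w → all? (x <?_) w ×-dec sorted? s w) S) ⟩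
         length (filter (λ w → all? (x <?_) w ×-dec sorted? s w) S)
           ≡⟨ cong length (filter-× (all? (x <?_)) (sorted? s) S) ⟩
         length (filter (sorted? s) (filter (all? (x <?_)) S))
           ≡⟨ cong (length ∘ filter (sorted? s)) (filter-subwords (x <?_) j σ) ⟩
         length (filter (sorted? s) (subwords j (above x σ)))
           ∎) ⟩
  length (filter (sorted? s) (subwords j (above x σ))) + length (filter P? (subwords (suc j) σ))
    ∎
  where
  open ≡-Reasoning
  S : List Word
  S = subwords j σ
  P? : Decidable (λ w → red w ≡ pat s j)
  P? w = ≡-dec _≟_ (red w) (pat s j)
  equiv : ∀ {w} → length w ≡ j → (red (x ∷ w) ≡ pat s j → All (x <_) w × Sorted s w)
                               × (All (x <_) w × Sorted s w → red (x ∷ w) ≡ pat s j)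
  equiv refl = red≡pat⁻ s j , λ { (x<w , sorted) → red≡pat⁺ s x<w sorted }

occr-[] : ∀ s j → occr (pat s j) [] ≡ 0
occr-[] s j rewrite length-pat s j = refl

-- For words with distinct letters this is equivalent to avoiding `pat (opposite s) 2`, by
-- `Good⇒avoids` and `avoids⇒Good`.
Good : Direction → Word → Set
Good s []      = ⊤
Good s (x ∷ σ) = Sorted s (above x σ) × Good s σ

weight : ℕ → Word → ℕ
weight j []      = 0
weight j (x ∷ σ) = length (above x σ) choose j + weight j σ

-- Every subword of a sorted word is sorted, so the filter in `occr-∷` discards nothing and a letter
-- of height k starts C(k, j) occurrences.
occr≡weight : ∀ s j σ → Good s σ → occr (pat s j) σ ≡ weight j σ
occr≡weight s j []      _               = occr-[] s j
occr≡weight s j (x ∷ σ) (sorted , good) = begin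
  occr (pat s j) (x ∷ σ)
    ≡⟨ occr-∷ s j x σ ⟩
  length (filter (sorted? s) (subwords j (above x σ))) + occr (pat s j) σ
    ≡⟨ cong₂ (λ v n → length v + n) (filter-all (sorted? s) (subwords-AllPairs j sorted)) (occr≡weight s j σ good) ⟩
  length (subwords j (above x σ)) + weight j σ
    ≡⟨ cong (_+ weight j σ) (length-subwords j (above x σ)) ⟩
  weight j (x ∷ σ)
    ∎
  where open ≡-Reasoning

Good⇒avoids : ∀ s σ → Good s σ → occr (pat (opposite s) 2) σ ≡ 0
Good⇒avoids s []      _               = occr-[] (opposite s) 2
Good⇒avoids s (x ∷ σ) (sorted , good) = trans (occr-∷ (opposite s) 2 x σ) (cong₂ _+_
  (cong length (filter-none (sorted? (opposite s))
    (All.zipWith not-opposite (subwords-length 2 (above x σ) , subwords-AllPairs 2 sorted))))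
  (Good⇒avoids s σ good))
  where
  not-opposite : ∀ {w} → length w ≡ 2 × Sorted s w → ¬ Sorted (opposite s) w
  not-opposite {_ ∷ _ ∷ []} (_ , (r ∷ []) ∷ _) ((r′ ∷ []) ∷ _) = Ordered-asym s r r′

-- Two distinct letters that are not ordered in the opposite direction are ordered in direction s,
-- and every pair of positions appears among the two-letter subwords.
sorted-by-pairs : ∀ s {σ} → Unique σ → All (λ w → ¬ Sorted (opposite s) w) (subwords 2 σ) → Sorted s σ
sorted-by-pairs s []                  _    = []
sorted-by-pairs s {x ∷ σ} (x∉σ ∷ uniq) none =
  All.zipWith (λ { (x≢y , ¬r) → Ordered-total s x≢y ¬r }) (x∉σ , singletons σ (All.map⁻ (All.++⁻ˡ (map (x ∷_) (subwords 1 σ)) none)))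
    ∷ sorted-by-pairs s uniq (All.++⁻ʳ (map (x ∷_) (subwords 1 σ)) none)
  where
  singletons : ∀ σ → All (λ w → ¬ Sorted (opposite s) (x ∷ w)) (subwords 1 σ) → All (λ y → ¬ Ordered (opposite s) x y) σ
  singletons []      []       = []
  singletons (y ∷ σ) (¬r ∷ rs) = (λ r → ¬r ((r ∷ []) ∷ [] ∷ [])) ∷ singletons σ rs

avoids⇒Good : ∀ s {σ} → Unique σ → occr (pat (opposite s) 2) σ ≡ 0 → Good s σ
avoids⇒Good s []                     _  = tt
avoids⇒Good s {x ∷ σ} (x∉σ ∷ uniq) eq =
    sorted-by-pairs s (AllPairs.filter⁺ (x <?_) uniq)
      (length-filter≡0⇒none (sorted? (opposite s)) (subwords 2 (above x σ)) (m+n≡0⇒m≡0 _ eq′))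
  , avoids⇒Good s uniq (m+n≡0⇒n≡0 (length (filter (sorted? (opposite s)) (subwords 2 (above x σ)))) eq′)
  where
  eq′ = trans (sym (occr-∷ (opposite s) 2 x σ)) eq

-- The increasing map whose image omits exactly v: it makes room for a new letter v without changing
-- the relative order of the old ones.
bump : ℕ → ℕ → ℕ
bump zero    x       = suc x
bump (suc v) zero    = zero
bump (suc v) (suc x) = suc (bump v x)

bump-≥ : ∀ {v x} → v ≤ x → bump v x ≡ suc x
bump-≥ z≤n       = refl
bump-≥ (s≤s v≤x) = cong suc (bump-≥ v≤x)

bump-< : ∀ {v x} → x < v → bump v x ≡ x
bump-< {suc v} {zero}  _         = refl
bump-< {suc v} {suc x} (s≤s x<v) = cong suc (bump-< x<v)

bump-mono-< : ∀ v {x y} → x < y → bump v x < bump v y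
bump-mono-< zero    x<y                     = s≤s x<y
bump-mono-< (suc v) {zero}  {suc y} _       = s≤s z≤n
bump-mono-< (suc v) {suc x} {suc y} (s≤s x<y) = s≤s (bump-mono-< v x<y)

bump-cancel-< : ∀ v {x y} → bump v x < bump v y → x < y
bump-cancel-< zero    (s≤s lt)                  = lt
bump-cancel-< (suc v) {zero}  {suc y} _         = s≤s z≤n
bump-cancel-< (suc v) {suc x} {suc y} (s≤s lt)  = s≤s (bump-cancel-< v lt)

bump-injective : ∀ v {x y} → bump v x ≡ bump v y → x ≡ y
bump-injective zero    eq                = suc-injective eq
bump-injective (suc v) {zero}  {zero}  _ = refl
bump-injective (suc v) {suc x} {suc y} eq = cong suc (bump-injective v (suc-injective eq))

bump-≢ : ∀ v x → v ≢ bump v x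
bump-≢ (suc v) (suc x) eq = bump-≢ v x (suc-injective eq)

bump-≤-suc : ∀ v x → bump v x ≤ suc x
bump-≤-suc zero    x       = ≤-refl
bump-≤-suc (suc v) zero    = z≤n
bump-≤-suc (suc v) (suc x) = s≤s (bump-≤-suc v x)

bump-surjective : ∀ {v y n} → v ≢ y → v ≤ n → y ≤ n → ∃ λ x → x < n × y ≡ bump v x
bump-surjective {zero}  {zero}  {n}     v≢y _         _         = contradiction refl v≢y
bump-surjective {zero}  {suc y} {n}     v≢y _         y<n       = y , y<n , refl
bump-surjective {suc v} {zero}  {suc n} v≢y _         _         = zero , s≤s z≤n , refl
bump-surjective {suc v} {suc y} {suc n} v≢y (s≤s v≤n) (s≤s y≤n)
  with x , x<n , eq ← bump-surjective (v≢y ∘ cong suc) v≤n y≤n = suc x , s≤s x<n , cong suc eq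

below-bump⁻ : ∀ {v x y} → x < v → x < bump v y → x < y
below-bump⁻ {v} {x} {y} x<v lt = bump-cancel-< v (subst (_< bump v y) (sym (bump-< x<v)) lt)

below-bump⁺ : ∀ {v x y} → x < v → x < y → x < bump v y
below-bump⁺ {v} {x} {y} x<v lt = subst (_< bump v y) (bump-< x<v) (bump-mono-< v lt)

suc-above-bump⁻ : ∀ {v x y} → v ≤ x → suc x < bump (suc v) y → x < y
suc-above-bump⁻ {v} {x} {suc y} v≤x (s≤s lt) = ≤-trans lt (bump-≤-suc v y)

suc-above-bump⁺ : ∀ {v x y} → v ≤ x → x < y → suc x < bump (suc v) y
suc-above-bump⁺ {v} {x} {suc y} v≤x (s≤s x≤y) = s≤s (subst (x <_) (sym (bump-≥ (≤-trans v≤x x≤y))) (s≤s x≤y))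

above-map : ∀ (f : ℕ → ℕ) x z σ → (∀ {y} → x < f y → z < y) → (∀ {y} → z < y → x < f y) →
            above x (map f σ) ≡ map f (above z σ)
above-map f x z σ to from = filter-map (x <?_) (z <?_) f (All.universal (λ _ → to , from) σ)

above-bump : ∀ v x σ → above (bump v x) (map (bump v) σ) ≡ map (bump v) (above x σ)
above-bump v x σ = above-map (bump v) (bump v x) x σ (bump-cancel-< v) (bump-mono-< v)

Sorted-bump⁺ : ∀ s v {σ} → Sorted s σ → Sorted s (map (bump v) σ)
Sorted-bump⁺ s v = AllPairs.map⁺ ∘ AllPairs.map (Ordered-preserve s {bump v} (bump-mono-< v))

Sorted-bump⁻ : ∀ s v {σ} → Sorted s (map (bump v) σ) → Sorted s σ
Sorted-bump⁻ s v = AllPairs.map (Ordered-reflect s {bump v} (bump-cancel-< v)) ∘ AllPairs.map⁻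

Good-bump⁺ : ∀ s v σ → Good s σ → Good s (map (bump v) σ)
Good-bump⁺ s v []      _               = tt
Good-bump⁺ s v (x ∷ σ) (sorted , good) =
  subst (Sorted s) (sym (above-bump v x σ)) (Sorted-bump⁺ s v sorted) , Good-bump⁺ s v σ good

Good-bump⁻ : ∀ s v σ → Good s (map (bump v) σ) → Good s σ
Good-bump⁻ s v []      _               = tt
Good-bump⁻ s v (x ∷ σ) (sorted , good) =
  Sorted-bump⁻ s v (subst (Sorted s) (above-bump v x σ) sorted) , Good-bump⁻ s v σ good

weight-bump : ∀ j v σ → weight j (map (bump v) σ) ≡ weight j σ
weight-bump j v []      = refl
weight-bump j v (x ∷ σ) = cong₂ _+_
  (cong (_choose j) (trans (cong length (above-bump v x σ)) (length-map (bump v) (above x σ))))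
  (weight-bump j v σ)

-- Prepends a letter that exceeds exactly x of the letters of a permutation.
insert : ℕ → Word → Word
insert x σ = suc x ∷ map (bump (suc x)) σ

insert-injective : ∀ {σ τ x y} → insert x σ ≡ insert y τ → σ ≡ τ × x ≡ y
insert-injective eq with ∷-injective eq
... | refl , eq′ = map-injective (bump-injective _) eq′ , refl

Unique-insert : ∀ x {σ} → Unique σ → Unique (insert x σ)
Unique-insert x {σ} uniq =
  All.map⁺ (All.universal (bump-≢ (suc x)) σ) ∷ Unique.map⁺ (bump-injective (suc x)) uniq

above-insert-≤ : ∀ {x v} σ → x ≤ v → above x (insert v σ) ≡ suc v ∷ map (bump (suc v)) (above x σ)
above-insert-≤ {x} {v} σ x≤v = trans
  (filter-accept (x <?_) (s≤s x≤v))
  (cong (suc v ∷_) (above-map (bump (suc v)) x x σ (below-bump⁻ (s≤s x≤v)) (below-bump⁺ (s≤s x≤v))))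

above-insert-> : ∀ {x v} σ → v ≤ x → above (suc x) (insert v σ) ≡ map (bump (suc v)) (above x σ)
above-insert-> {x} {v} σ v≤x = trans
  (filter-reject (suc x <?_) (≤⇒≯ (s≤s v≤x)))
  (above-map (bump (suc v)) (suc x) x σ (suc-above-bump⁻ v≤x) (suc-above-bump⁺ v≤x))

above-insert-head : ∀ v σ → above (suc v) (map (bump (suc v)) σ) ≡ map (bump (suc v)) (above v σ)
above-insert-head v σ =
  above-map (bump (suc v)) (suc v) v σ (suc-above-bump⁻ ≤-refl) (suc-above-bump⁺ ≤-refl)

Good-insert⁺ : ∀ s x σ → Good s σ → Sorted s (above x σ) → Good s (insert x σ)
Good-insert⁺ s x σ good sorted =
    subst (Sorted s) (sym (above-insert-head x σ)) (Sorted-bump⁺ s (suc x) sorted)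
  , Good-bump⁺ s (suc x) σ good

Good-insert⁻ : ∀ s x σ → Good s (insert x σ) → Good s σ × Sorted s (above x σ)
Good-insert⁻ s x σ (sorted , good) =
    Good-bump⁻ s (suc x) σ good
  , Sorted-bump⁻ s (suc x) (subst (Sorted s) (above-insert-head x σ) sorted)

weight-insert : ∀ j x σ → weight j (insert x σ) ≡ length (above x σ) choose j + weight j σ
weight-insert j x σ = cong₂ _+_
  (cong (_choose j) (trans (cong length (above-insert-head x σ)) (length-map (bump (suc x)) (above x σ))))
  (weight-bump j (suc x) σ)

-- The permutations of {1, …, n + 1} arise by insertion from those of {1, …, n}

words-Unique : ∀ {A} → Unique A → ∀ k → Unique (words A k)
words-Unique uniq zero    = [] ∷ []
words-Unique uniq (suc k) = Unique.cartesianProductWith⁺ _∷_ ∷-injective uniq (words-Unique uniq k)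

∈-words⁺ : ∀ {A w} → All (_∈ A) w → w ∈ words A (length w)
∈-words⁺ []          = here refl
∈-words⁺ (x∈A ∷ w⊆A) = ∈-cartesianProductWith⁺ _∷_ x∈A (∈-words⁺ w⊆A)

∈-words⁻ : ∀ A k {w} → w ∈ words A k → All (_∈ A) w × length w ≡ k
∈-words⁻ A zero    (here refl) = [] , refl
∈-words⁻ A (suc k) w∈ with ∈-cartesianProductWith⁻ _∷_ A (words A k) w∈
... | x , w , x∈A , w∈words , refl with ∈-words⁻ A k w∈words
...   | w⊆A , refl = x∈A ∷ w⊆A , refl

Letter : ℕ → ℕ → Set
Letter n x = ∃ λ i → i < n × x ≡ suc i

∈-𝒮⁺ : ∀ {σ} → All (Letter (length σ)) σ → Unique σ → σ ∈ 𝒮 (length σ)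
∈-𝒮⁺ letters uniq = ∈-filter⁺ unique?
  (∈-words⁺ (All.map (λ { (_ , i<n , refl) → ∈-applyUpTo⁺ suc i<n }) letters)) uniq

∈-𝒮⁻ : ∀ n {σ} → σ ∈ 𝒮 n → All (Letter n) σ × Unique σ × length σ ≡ n
∈-𝒮⁻ n σ∈ with ∈-filter⁻ unique? {xs = words (applyUpTo suc n) n} σ∈
... | σ∈words , uniq with ∈-words⁻ (applyUpTo suc n) n σ∈words
...   | letters , len = All.map (∈-applyUpTo⁻ suc) letters , uniq , len

insert-∈-𝒮 : ∀ {n x σ} → x ≤ n → σ ∈ 𝒮 n → insert x σ ∈ 𝒮 (suc n)
insert-∈-𝒮 {n} {x} {σ} x≤n σ∈ with ∈-𝒮⁻ n σ∈
... | letters , uniq , refl = subst (λ m → insert x σ ∈ 𝒮 (suc m)) (length-map (bump (suc x)) σ)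
  (∈-𝒮⁺ (subst (λ m → All (Letter (suc m)) (insert x σ)) (sym (length-map (bump (suc x)) σ))
           ((x , s≤s x≤n , refl) ∷ All.map⁺ (All.map bump-letter letters)))
         (Unique-insert x uniq))
  where
  bump-letter : ∀ {y} → Letter n y → Letter (suc n) (bump (suc x) y)
  bump-letter (i , i<n , refl) = bump x i , s≤s (≤-trans (bump-≤-suc x i) i<n) , refl

-- The letters of w differ from the first letter `suc x`, so the gap can be closed letter by letter.
unbump : ∀ {n x w} → x ≤ n → All (λ z → suc x ≢ z × Letter (suc n) z) w →
         ∃ λ σ → All (Letter n) σ × w ≡ map (bump (suc x)) σ
unbump x≤n []                                  = [] , [] , refl
unbump x≤n ((x≢z , i , s≤s i≤n , refl) ∷ rest)
  with σ , letters , refl ← unbump x≤n rest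
     | k , k<n , refl ← bump-surjective (x≢z ∘ cong suc) x≤n i≤n
  = suc k ∷ σ , (k , k<n , refl) ∷ letters , refl

∈-𝒮-suc : ∀ n {τ} → τ ∈ 𝒮 (suc n) → ∃₂ λ x σ → x ≤ n × σ ∈ 𝒮 n × τ ≡ insert x σ
∈-𝒮-suc n {[]}    τ∈ with () ← proj₂ (proj₂ (∈-𝒮⁻ (suc n) τ∈))
∈-𝒮-suc n {y ∷ w} τ∈ with ∈-𝒮⁻ (suc n) τ∈
... | (x , s≤s x≤n , refl) ∷ letters , x∉w ∷ uniq , len
  with σ , σ-letters , refl ← unbump x≤n (All.zip (x∉w , letters))
  with refl ← trans (sym (length-map (bump (suc x)) σ)) (suc-injective len) =
  x , σ , x≤n , ∈-𝒮⁺ σ-letters (Unique.map⁻ uniq) , refl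

𝒮-Unique : ∀ n → Unique (𝒮 n)
𝒮-Unique n = Unique.filter⁺ unique?
  (words-Unique (Unique.applyUpTo⁺₁ suc n (λ i<j _ → <⇒≢ (s≤s i<j))) n)

-- The values n, n - 1, ..., 0 are listed downwards so that the entry at index k inserts a letter of
-- height k; the admissible heights then form an initial segment of the list.
insertions : ℕ → List Word → List Word
insertions n Σ = cartesianProductWith (λ σ x → insert x σ) Σ (applyUpTo (n ∸_) (suc n))

-- Both lists are free of repetitions and have the same members, so they agree up to order, which is
-- enough for sums.
𝒮-suc-↭ : ∀ n → 𝒮 (suc n) ↭ insertions n (𝒮 n)
𝒮-suc-↭ n = ∼bag⇒↭ (unique∧set⇒bag (𝒮-Unique (suc n))
  (Unique.cartesianProductWith⁺ (λ σ x → insert x σ) insert-injective (𝒮-Unique n)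
    (Unique.applyUpTo⁺₁ (n ∸_) (suc n) (λ { i<j (s≤s j≤n) → ≢-sym (<⇒≢ (∸-monoʳ-< i<j j≤n)) })))
  (mk⇔ to from))
  where
  to : ∀ {τ} → τ ∈ 𝒮 (suc n) → τ ∈ insertions n (𝒮 n)
  to τ∈ with x , σ , x≤n , σ∈ , refl ← ∈-𝒮-suc n τ∈ =
    ∈-cartesianProductWith⁺ (λ σ x → insert x σ) σ∈
      (subst (_∈ applyUpTo (n ∸_) (suc n)) (m∸[m∸n]≡n x≤n) (∈-applyUpTo⁺ (n ∸_) (s≤s (m∸n≤m n x))))
  from : ∀ {τ} → τ ∈ insertions n (𝒮 n) → τ ∈ 𝒮 (suc n)
  from τ∈ with ∈-cartesianProductWith⁻ (λ σ x → insert x σ) (𝒮 n) (applyUpTo (n ∸_) (suc n)) τ∈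
  ... | σ , x , σ∈ , x∈ , refl with ∈-applyUpTo⁻ (n ∸_) {n = suc n} x∈
  ...   | k , _ , refl = insert-∈-𝒮 (m∸n≤m n k) σ∈

-- Summing over the insertion tree

avoiders : Direction → ℕ → List Word
avoiders s = 𝒮-avoiding (pat (opposite s) 2)

-- The sum of f over the children of σ in the generating tree: for an avoiding σ the filter keeps
-- exactly the insertions that still avoid.
extend : Direction → ℕ → (Word → ℕ) → Word → ℕ
extend s n f σ = sum (map (λ x → f (insert x σ)) (filter (λ x → sorted? s (above x σ)) (applyUpTo (n ∸_) (suc n))))

avoids? : ∀ s → Decidable (λ σ → occr (pat (opposite s) 2) σ ≡ 0)
avoids? s σ = occr (pat (opposite s) 2) σ ≟ 0

filter-avoids-insert : ∀ s {σ} → Unique σ → occr (pat (opposite s) 2) σ ≡ 0 → ∀ xs →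
  filter (avoids? s) (map (λ x → insert x σ) xs) ≡
  map (λ x → insert x σ) (filter (λ x → sorted? s (above x σ)) xs)
filter-avoids-insert s {σ} uniq avoids xs =
  filter-map (avoids? s) (λ x → sorted? s (above x σ)) (λ x → insert x σ) (All.universal equiv xs)
  where
  equiv : ∀ x → (occr (pat (opposite s) 2) (insert x σ) ≡ 0 → Sorted s (above x σ))
              × (Sorted s (above x σ) → occr (pat (opposite s) 2) (insert x σ) ≡ 0)
  equiv x = (λ eq → proj₂ (Good-insert⁻ s x σ (avoids⇒Good s (Unique-insert x uniq) eq)))
          , (λ sorted → Good⇒avoids s (insert x σ) (Good-insert⁺ s x σ (avoids⇒Good s uniq avoids) sorted))

filter-avoids-insert-none : ∀ s {σ} → Unique σ → occr (pat (opposite s) 2) σ ≢ 0 → ∀ xs →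
  filter (avoids? s) (map (λ x → insert x σ) xs) ≡ []
filter-avoids-insert-none s {σ} uniq ¬avoids xs = filter-none (avoids? s) (All.map⁺ (All.universal
  (λ x eq → ¬avoids (Good⇒avoids s σ (proj₁ (Good-insert⁻ s x σ (avoids⇒Good s (Unique-insert x uniq) eq))))) xs))

-- Removing the first letter of an avoiding permutation leaves an avoiding one. So the insertions
-- into a σ that does not avoid all drop out, and those into an avoiding σ contribute
-- `extend s n f σ`.
sum-avoiding-insertions : ∀ s n f {Σ} → All Unique Σ →
  sum (map f (filter (avoids? s) (insertions n Σ))) ≡ sum (map (extend s n f) (filter (avoids? s) Σ))
sum-avoiding-insertions s n f []                       = refl
sum-avoiding-insertions s n f {σ ∷ Σ} (uniq ∷ uniqs) = begin
  sum (map f (filter (avoids? s) (map (λ x → insert x σ) xs ++ insertions n Σ)))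
    ≡⟨ cong (sum ∘ map f) (filter-++ (avoids? s) (map (λ x → insert x σ) xs) (insertions n Σ)) ⟩
  sum (map f (A ++ filter (avoids? s) (insertions n Σ)))
    ≡⟨ cong sum (map-++ f A (filter (avoids? s) (insertions n Σ))) ⟩
  sum (map f A ++ map f (filter (avoids? s) (insertions n Σ)))
    ≡⟨ sum-++ (map f A) (map f (filter (avoids? s) (insertions n Σ))) ⟩
  sum (map f A) + sum (map f (filter (avoids? s) (insertions n Σ)))
    ≡⟨ cong (sum (map f A) +_) (sum-avoiding-insertions s n f uniqs) ⟩
  sum (map f A) + sum (map (extend s n f) (filter (avoids? s) Σ))
    ≡⟨ by-cases (avoids? s σ) ⟩
  sum (map (extend s n f) (filter (avoids? s) (σ ∷ Σ)))
    ∎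
  where
  open ≡-Reasoning
  xs : List ℕ
  xs = applyUpTo (n ∸_) (suc n)
  A : List Word
  A = filter (avoids? s) (map (λ x → insert x σ) xs)
  rest : ℕ
  rest = sum (map (extend s n f) (filter (avoids? s) Σ))
  by-cases : Dec (occr (pat (opposite s) 2) σ ≡ 0) →
             sum (map f A) + rest ≡ sum (map (extend s n f) (filter (avoids? s) (σ ∷ Σ)))
  by-cases (yes avoids) = begin
    sum (map f A) + rest
      ≡⟨ cong (λ B → sum (map f B) + rest) (filter-avoids-insert s uniq avoids xs) ⟩
    sum (map f (map (λ x → insert x σ) (filter (λ x → sorted? s (above x σ)) xs))) + rest
      ≡⟨ cong (λ B → sum B + rest) (map-∘ (filter (λ x → sorted? s (above x σ)) xs)) ⟨
    sum (map (extend s n f) (σ ∷ filter (avoids? s) Σ))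
      ≡⟨ cong (sum ∘ map (extend s n f)) (filter-accept (avoids? s) avoids) ⟨
    sum (map (extend s n f) (filter (avoids? s) (σ ∷ Σ)))
      ∎
  by-cases (no ¬avoids) = begin
    sum (map f A) + rest
      ≡⟨ cong (λ B → sum (map f B) + rest) (filter-avoids-insert-none s uniq ¬avoids xs) ⟩
    rest
      ≡⟨ cong (sum ∘ map (extend s n f)) (filter-reject (avoids? s) ¬avoids) ⟨
    sum (map (extend s n f) (filter (avoids? s) (σ ∷ Σ)))
      ∎

sum-avoiders-suc : ∀ s n f → sum (map f (avoiders s (suc n))) ≡ sum (map (extend s n f) (avoiders s n))
sum-avoiders-suc s n f = trans
  (sum-↭ (map⁺ f (filter-↭ (avoids? s) (𝒮-suc-↭ n))))
  (sum-avoiding-insertions s n f (All.tabulate (λ σ∈ → proj₁ (proj₂ (∈-𝒮⁻ n σ∈)))))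

extendBy : Direction → ℕ → ℕ → (Word → ℕ) → Word → ℕ
extendBy s zero    n f = f
extendBy s (suc r) n f = extend s n (extendBy s r (suc n) f)

sum-avoiders-+ : ∀ s r n f → sum (map f (avoiders s (r + n))) ≡ sum (map (extendBy s r n f) (avoiders s n))
sum-avoiders-+ s zero    n f = refl
sum-avoiders-+ s (suc r) n f = begin
  sum (map f (avoiders s (suc (r + n))))                          ≡⟨ cong (sum ∘ map f ∘ avoiders s) (+-suc r n) ⟨
  sum (map f (avoiders s (r + suc n)))                            ≡⟨ sum-avoiders-+ s r (suc n) f ⟩
  sum (map (extendBy s r (suc n) f) (avoiders s (suc n)))         ≡⟨ sum-avoiders-suc s n (extendBy s r (suc n) f) ⟩
  sum (map (extendBy s (suc r) n f) (avoiders s n))               ∎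
  where open ≡-Reasoning

sum-avoiders : ∀ s n f → sum (map f (avoiders s n)) ≡ extendBy s n 0 f []
sum-avoiders s n f = begin
  sum (map f (avoiders s n))                    ≡⟨ cong (sum ∘ map f ∘ avoiders s) (+-identityʳ n) ⟨
  sum (map f (avoiders s (n + 0)))              ≡⟨ sum-avoiders-+ s n 0 f ⟩
  sum (map (extendBy s n 0 f) (avoiders s 0))   ≡⟨ cong (sum ∘ map (extendBy s n 0 f)) (avoiders-0 s) ⟩
  extendBy s n 0 f [] + 0                       ≡⟨ +-identityʳ _ ⟩
  extendBy s n 0 f []                           ∎
  where
  open ≡-Reasoning
  avoiders-0 : ∀ s → avoiders s 0 ≡ [] ∷ []
  avoiders-0 up   = refl
  avoiders-0 down = refl

-- The label of the node reached from a node with label d by inserting a letter with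
-- k larger letters.
child : Direction → ℕ → ℕ → ℕ
child up   d k       = suc k
child down d zero    = suc d
child down d (suc k) = suc k

-- The label d of a permutation σ is the largest number such that the d largest
-- letters of σ are sorted.
record Node (s : Direction) (n : ℕ) (σ : Word) (d : ℕ) : Set where
  field
    label≤ : d ≤ n
    bounded : All (_≤ n) σ
    contains : ∀ {x} → x < n → suc x ∈ σ
    count : ∀ {x k} → x + k ≡ n → length (above x σ) ≡ k
    label⁻ : ∀ {x k} → x + k ≡ n → Sorted s (above x σ) → k ≤ d
    label⁺ : ∀ {x k} → x + k ≡ n → k ≤ d → Sorted s (above x σ)

open Node

root : ∀ s → Node s 0 [] 0
root s = record
  { label≤ = z≤n ; bounded = [] ; contains = λ ()
  ; count = λ { {zero} {zero} _ → refl }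
  ; label⁻ = λ { {zero} {zero} _ _ → z≤n }
  ; label⁺ = λ _ _ → [] }

-- Locates a threshold relative to the new letter `suc v`. In case `low` the new letter lies above
-- it and adds one to the old number k of larger letters; in case `high` it does not, and the
-- threshold was one smaller before the insertion.
data Threshold (v n : ℕ) : ℕ → ℕ → Set where
  low  : ∀ {x k} → x ≤ v → x + k ≡ n → Threshold v n x (suc k)
  high : ∀ {x k} → v ≤ x → x + k ≡ n → Threshold v n (suc x) k

threshold : ∀ {v n x k} → v ≤ n → x + k ≡ suc n → Threshold v n x k
threshold {v} {n} {x} {k} v≤n eq with x ≤? v
threshold {v} {n} {x}     {zero}  v≤n eq | yes x≤v =
  contradiction (≤-trans x≤v v≤n) (<⇒≱ (subst (n <_) (trans (sym eq) (+-identityʳ x)) ≤-refl))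
threshold {v} {n} {x}     {suc k} v≤n eq | yes x≤v = low x≤v (suc-injective (trans (sym (+-suc x k)) eq))
threshold {v} {n} {zero}  {k}     v≤n eq | no x≰v = contradiction z≤n x≰v
threshold {v} {n} {suc x} {k}     v≤n eq | no x≰v = high (≤-pred (≰⇒> x≰v)) (suc-injective eq)

complement-≤ : ∀ {x k y l n : ℕ} → x + k ≡ n → y + l ≡ n → x ≤ y → l ≤ k
complement-≤ {x} {k} {y} {l} refl eq x≤y =
  +-cancelˡ-≤ y l k (≤-trans (≤-reflexive eq) (+-monoˡ-≤ k x≤y))

module _ {s n σ d v k} (node : Node s n σ d) (v+k≡n : v + k ≡ n) (k≤d : k ≤ d) where

  private
    v≤n : v ≤ n
    v≤n = subst (v ≤_) v+k≡n (m≤m+n v k)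

    b : ℕ → ℕ
    b = bump (suc v)

  insert-bounded : All (_≤ suc n) (insert v σ)
  insert-bounded = s≤s v≤n ∷ All.map⁺ (All.map (λ {y} y≤n → ≤-trans (bump-≤-suc (suc v) y) (s≤s y≤n)) (bounded node))

  insert-contains : ∀ {x} → x < suc n → suc x ∈ insert v σ
  insert-contains {x} (s≤s x≤n) with suc v ≟ suc x
  ... | yes eq = here (sym eq)
  ... | no v≢x with y , y<n , eq ← bump-surjective (v≢x ∘ cong suc) v≤n x≤n =
    there (subst (_∈ map b σ) (cong suc (sym eq)) (∈-map⁺ b (contains node y<n)))

  insert-count : ∀ {x l} → x + l ≡ suc n → length (above x (insert v σ)) ≡ l
  insert-count {x} {l} eq with threshold {x = x} {l} v≤n eq
  ... | low  x≤v eq′ = trans (cong length (above-insert-≤ σ x≤v)) (cong suc (trans (length-map b (above x σ)) (count node eq′)))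
  ... | high {x′} v≤x eq′ = trans (cong length (above-insert-> σ v≤x)) (trans (length-map b (above x′ σ)) (count node eq′))

  above-letter : ∀ {x y} → x ≤ y → y < n → b (suc y) ∈ map b (above x σ)
  above-letter {x} x≤y y<n = ∈-map⁺ b (∈-filter⁺ (x <?_) (contains node y<n) (s≤s x≤y))

  insert-sorted-high : ∀ {x l} → v ≤ x → x + l ≡ n → Sorted s (above (suc x) (insert v σ))
  insert-sorted-high v≤x eq = subst (Sorted s) (sym (above-insert-> σ v≤x))
    (Sorted-bump⁺ s (suc v) (label⁺ node eq (≤-trans (complement-≤ v+k≡n eq v≤x) k≤d)))

  insert-sorted-low⁻ : ∀ {x} → x ≤ v → Sorted s (above x (insert v σ)) →
                       All (Ordered s (suc v)) (map b (above x σ)) × Sorted s (above x σ)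
  insert-sorted-low⁻ x≤v sorted with r ∷ rs ← subst (Sorted s) (above-insert-≤ σ x≤v) sorted =
    r , Sorted-bump⁻ s (suc v) rs

  insert-sorted-low⁺ : ∀ {x} → x ≤ v → All (Ordered s (suc v)) (map b (above x σ)) → Sorted s (above x σ) →
                       Sorted s (above x (insert v σ))
  insert-sorted-low⁺ x≤v r sorted =
    subst (Sorted s) (sym (above-insert-≤ σ x≤v)) (r ∷ Sorted-bump⁺ s (suc v) sorted)

-- The new letter precedes the k larger ones, which are increasing, so the k + 1 largest letters are
-- increasing. One more would put a smaller letter to its right.
insert-up : ∀ {n σ d v k} → Node up n σ d → v + k ≡ n → k ≤ d → Node up (suc n) (insert v σ) (suc k)
insert-up {n} {σ} {d} {v} {k} node v+k≡n k≤d = record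
  { label≤   = s≤s (subst (k ≤_) v+k≡n (m≤n+m k v))
  ; bounded  = insert-bounded node v+k≡n k≤d
  ; contains = insert-contains node v+k≡n k≤d
  ; count    = insert-count node v+k≡n k≤d
  ; label⁻   = l⁻
  ; label⁺   = l⁺
  }
  where
  v≤n : v ≤ n
  v≤n = subst (v ≤_) v+k≡n (m≤m+n v k)
  l⁻ : ∀ {x l} → x + l ≡ suc n → Sorted up (above x (insert v σ)) → l ≤ suc k
  l⁻ {x} {l} eq sorted with threshold {x = x} {l} v≤n eq
  ... | high v≤x eq′ = m≤n⇒m≤1+n (complement-≤ v+k≡n eq′ v≤x)
  ... | low {x} x≤v eq′ with m≤n⇒m<n∨m≡n x≤v
  ...   | inj₂ refl = s≤s (complement-≤ v+k≡n eq′ ≤-refl)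
  -- The witness is the letter x + 1 of σ: it lies below `suc v`, is left fixed by `bump`, and
  -- stands to the right of the new letter.
  ...   | inj₁ x<v  = contradiction
    (subst (suc v <_) (bump-< (s≤s x<v))
      (All.lookup (proj₁ (insert-sorted-low⁻ node v+k≡n k≤d x≤v sorted))
                  (above-letter node v+k≡n k≤d ≤-refl (≤-trans x<v v≤n))))
    (<-asym (s≤s x<v))
  l⁺ : ∀ {x l} → x + l ≡ suc n → l ≤ suc k → Sorted up (above x (insert v σ))
  l⁺ {x} {l} eq l≤ with threshold {x = x} {l} v≤n eq
  ... | high v≤x eq′ = insert-sorted-high node v+k≡n k≤d v≤x eq′
  ... | low {x} {l} x≤v eq′ = insert-sorted-low⁺ node v+k≡n k≤d x≤v
    (All.map⁺ (All.map larger (All.all-filter (x <?_) σ)))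
    (label⁺ node eq′ (≤-trans (≤-pred l≤) k≤d))
    where
    v≤x : v ≤ x
    v≤x = complement-≤ (trans (+-comm l x) eq′) (trans (+-comm k v) v+k≡n) (≤-pred l≤)
    larger : ∀ {y} → x < y → suc v < bump (suc v) y
    larger x<y = suc-above-bump⁺ ≤-refl (≤-trans (s≤s v≤x) x<y)

-- A new maximum in front extends the decreasing run of the d largest letters to d + 1. Otherwise a
-- larger letter follows the new one, so the run stops just before including it, at length k.
insert-down : ∀ {n σ d v k} → Node down n σ d → v + k ≡ n → k ≤ d → Node down (suc n) (insert v σ) (child down d k)
insert-down {n} {σ} {d} {v} {k} node v+k≡n k≤d = record
  { label≤   = child≤ k (subst (k ≤_) v+k≡n (m≤n+m k v))
  ; bounded  = insert-bounded node v+k≡n k≤d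
  ; contains = insert-contains node v+k≡n k≤d
  ; count    = insert-count node v+k≡n k≤d
  ; label⁻   = l⁻
  ; label⁺   = l⁺
  }
  where
  v≤n : v ≤ n
  v≤n = subst (v ≤_) v+k≡n (m≤m+n v k)
  child≤ : ∀ k → k ≤ n → child down d k ≤ suc n
  child≤ zero    _   = s≤s (label≤ node)
  child≤ (suc k) k≤n = m≤n⇒m≤1+n k≤n
  ≤child : ∀ k → k ≤ child down d k
  ≤child zero    = z≤n
  ≤child (suc k) = ≤-refl
  low⁻ : ∀ {x l} k → v + k ≡ n → x ≤ v → x + l ≡ n →
         All (suc v >_) (map (bump (suc v)) (above x σ)) → Sorted down (above x σ) → suc l ≤ child down d k
  low⁻ zero    _  _   eq _    sorted = s≤s (label⁻ node eq sorted)
  -- As k > 0, σ contains the letter v + 1; it becomes v + 2 and stands to the right of the smaller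
  -- new letter.
  low⁻ (suc k) eq x≤v _  less _      = contradiction
    (subst (_< suc v) (bump-≥ {suc v} ≤-refl) (All.lookup less (above-letter node v+k≡n k≤d x≤v (subst (v <_) eq (m<m+n v (s≤s z≤n))))))
    (<⇒≯ ≤-refl)
  l⁻ : ∀ {x l} → x + l ≡ suc n → Sorted down (above x (insert v σ)) → l ≤ child down d k
  l⁻ {x} {l} eq sorted with threshold {x = x} {l} v≤n eq
  ... | high v≤x eq′ = ≤-trans (complement-≤ v+k≡n eq′ v≤x) (≤child k)
  ... | low  x≤v eq′ with less , sorted′ ← insert-sorted-low⁻ node v+k≡n k≤d x≤v sorted =
    low⁻ k v+k≡n x≤v eq′ less sorted′
  low⁺ : ∀ {x l} k → v + k ≡ n → x ≤ v → x + l ≡ n → suc l ≤ child down d k →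
         All (suc v >_) (map (bump (suc v)) (above x σ)) × Sorted down (above x σ)
  -- Height 0 means v = n, so every old letter is at most v and smaller than the new one.
  low⁺ {x} zero    eq x≤v eq′ (s≤s l≤d) =
      All.map⁺ (All.filter⁺ (x <?_) (All.map smaller (bounded node)))
    , label⁺ node eq′ l≤d
    where
    smaller : ∀ {y} → y ≤ n → bump (suc v) y < suc v
    smaller {y} y≤n with y≤v ← subst (y ≤_) (trans (sym eq) (+-identityʳ v)) y≤n =
      subst (_< suc v) (sym (bump-< (s≤s y≤v))) (s≤s y≤v)
  low⁺ (suc k) eq x≤v eq′ (s≤s l≤k) = contradiction (complement-≤ eq′ eq x≤v) (<⇒≱ (s≤s l≤k))
  l⁺ : ∀ {x l} → x + l ≡ suc n → l ≤ child down d k → Sorted down (above x (insert v σ))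
  l⁺ {x} {l} eq l≤ with threshold {x = x} {l} v≤n eq
  ... | high v≤x eq′ = insert-sorted-high node v+k≡n k≤d v≤x eq′
  ... | low  x≤v eq′ with less , sorted ← low⁺ k v+k≡n x≤v eq′ l≤ =
    insert-sorted-low⁺ node v+k≡n k≤d x≤v less sorted

Node-insert : ∀ s {n σ d v k} → Node s n σ d → v + k ≡ n → k ≤ d → Node s (suc n) (insert v σ) (child s d k)
Node-insert up   = insert-up
Node-insert down = insert-down

sum-filter-prefix : ∀ {P : ℕ → Set} (P? : Decidable P) (h φ : ℕ → ℕ) {N d} → d < N →
  (∀ {k} → k < N → P (h k) → k ≤ d) → (∀ {k} → k < N → k ≤ d → P (h k)) →
  sum (map φ (filter P? (applyUpTo h N))) ≡ sumTo (φ ∘ h) d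
sum-filter-prefix P? h φ {suc N} {zero} _ to from = begin
  sum (map φ (filter P? (h 0 ∷ applyUpTo (h ∘ suc) N)))
    ≡⟨ cong (sum ∘ map φ) (filter-accept P? (from (s≤s z≤n) z≤n)) ⟩
  φ (h 0) + sum (map φ (filter P? (applyUpTo (h ∘ suc) N)))
    ≡⟨ cong (λ xs → φ (h 0) + sum (map φ xs)) (filter-none P? (All.applyUpTo⁺₁ (h ∘ suc) N (λ k<N p → contradiction (to (s≤s k<N) p) λ ()))) ⟩
  φ (h 0) + 0
    ≡⟨ +-identityʳ (φ (h 0)) ⟩
  φ (h 0)
    ∎
  where open ≡-Reasoning
sum-filter-prefix P? h φ {suc N} {suc d} (s≤s d<N) to from = begin
  sum (map φ (filter P? (h 0 ∷ applyUpTo (h ∘ suc) N)))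
    ≡⟨ cong (sum ∘ map φ) (filter-accept P? (from (s≤s z≤n) z≤n)) ⟩
  φ (h 0) + sum (map φ (filter P? (applyUpTo (h ∘ suc) N)))
    ≡⟨ cong (φ (h 0) +_) (sum-filter-prefix P? (h ∘ suc) φ d<N
         (λ k<N p → ≤-pred (to (s≤s k<N) p)) (λ k<N k≤d → from (s≤s k<N) (s≤s k≤d))) ⟩
  φ (h 0) + sumTo (φ ∘ h ∘ suc) d
    ≡⟨ sumTo-head (φ ∘ h) d ⟨
  sumTo (φ ∘ h) (suc d)
    ∎
  where open ≡-Reasoning

extend-Node : ∀ {s n σ d} → Node s n σ d → ∀ f → extend s n f σ ≡ sumTo (λ k → f (insert (n ∸ k) σ)) d
extend-Node {s} {n} {σ} node f = sum-filter-prefix (λ x → sorted? s (above x σ)) (n ∸_) (λ x → f (insert x σ))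
  (s≤s (label≤ node))
  (λ { (s≤s k≤n) → label⁻ node (m∸n+n≡m k≤n) })
  (λ { (s≤s k≤n) → label⁺ node (m∸n+n≡m k≤n) })

-- For k ≥ 1 this is the label of the child of height k, which does not depend on the parent. The
-- child of height 0 has weight C(0, m - 1) = 0.
source : Direction → ℕ → ℕ
source up   k = suc k
source down k = k

-- In direction down the two sides distribute the labels differently over k; since w 0 = 0,
-- only the weights of the nodes k ≥ 1 matter, and those have label k.
sumTo-child : ∀ s (w : ℕ → ℕ) → w 0 ≡ 0 → ∀ (p u : ℕ → ℕ) a d →
  sumTo (λ k → (w k + a) · p (child s d k) + u (child s d k)) d ≡
  a · sumTo (p ∘ suc) d + sumTo (λ k → w k · p (source s k) + u (suc k)) d
sumTo-child up w _ p u a d = begin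
  sumTo (λ k → (w k + a) · p (suc k) + u (suc k)) d
    ≡⟨ sumTo-cong (λ k → rearrange (w k) a (p (suc k)) (u (suc k))) d ⟩
  sumTo (λ k → a · p (suc k) + (w k · p (suc k) + u (suc k))) d
    ≡⟨ sumTo-+ (λ k → a · p (suc k)) _ d ⟩
  sumTo (λ k → a · p (suc k)) d + sumTo (λ k → w k · p (suc k) + u (suc k)) d
    ≡⟨ cong (_+ sumTo (λ k → w k · p (suc k) + u (suc k)) d) (sumTo-*ˡ a (p ∘ suc) d) ⟩
  a · sumTo (p ∘ suc) d + sumTo (λ k → w k · p (suc k) + u (suc k)) d
    ∎
  where
  open ≡-Reasoning
  rearrange : ∀ w a p u → (w + a) · p + u ≡ a · p + (w · p + u)
  rearrange = solve-∀
sumTo-child down w w0≡0 p u a zero rewrite w0≡0 = refl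
sumTo-child down w w0≡0 p u a (suc d) = begin
  sumTo (λ k → (w k + a) · p (child down (suc d) k) + u (child down (suc d) k)) (suc d)
    ≡⟨ sumTo-head _ d ⟩
  (w 0 + a) · p (2 + d) + u (2 + d) + sumTo (λ k → (w (suc k) + a) · p (suc k) + u (suc k)) d
    ≡⟨ cong₂ (λ x y → (x + a) · p (2 + d) + u (2 + d) + y) w0≡0 (sumTo-cong (λ k → expand (w (suc k)) a (p (suc k)) (u (suc k))) d) ⟩
  a · p (2 + d) + u (2 + d) + sumTo (λ k → a · p (suc k) + (w (suc k) · p (suc k) + u (suc k))) d
    ≡⟨ cong (a · p (2 + d) + u (2 + d) +_) (trans (sumTo-+ (λ k → a · p (suc k)) _ d)
         (cong₂ _+_ (sumTo-*ˡ a (p ∘ suc) d) (sumTo-+ (λ k → w (suc k) · p (suc k)) (u ∘ suc) d))) ⟩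
  a · p (2 + d) + u (2 + d) + (a · sumTo (p ∘ suc) d + (W + sumTo (u ∘ suc) d))
    -- The children of height at least 1 have labels 1, ..., d + 1; the child of height 0, labelled
    -- d + 2, supplies the missing top term.
    ≡⟨ collect a (p (2 + d)) (u (2 + d)) (sumTo (p ∘ suc) d) W (sumTo (u ∘ suc) d) ⟩
  a · sumTo (p ∘ suc) (suc d) + (W + sumTo (u ∘ suc) (suc d))
    ≡⟨ cong (λ x → a · sumTo (p ∘ suc) (suc d) + (x · p 0 + W + sumTo (u ∘ suc) (suc d))) w0≡0 ⟨
  a · sumTo (p ∘ suc) (suc d) + (w 0 · p 0 + W + sumTo (u ∘ suc) (suc d))
    ≡⟨ cong (λ x → a · sumTo (p ∘ suc) (suc d) + (x + sumTo (u ∘ suc) (suc d))) (sumTo-head (λ k → w k · p k) d) ⟨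
  a · sumTo (p ∘ suc) (suc d) + (sumTo (λ k → w k · p k) (suc d) + sumTo (u ∘ suc) (suc d))
    ≡⟨ cong (a · sumTo (p ∘ suc) (suc d) +_) (sumTo-+ (λ k → w k · p k) (u ∘ suc) (suc d)) ⟨
  a · sumTo (p ∘ suc) (suc d) + sumTo (λ k → w k · p k + u (suc k)) (suc d)
    ∎
  where
  open ≡-Reasoning
  W : ℕ
  W = sumTo (λ k → w (suc k) · p (suc k)) d
  expand : ∀ w a p u → (w + a) · p + u ≡ a · p + (w · p + u)
  expand = solve-∀
  collect : ∀ a p u P W U → a · p + u + (a · P + (W + U)) ≡ a · (P + p) + (W + (U + u))
  collect = solve-∀

source-⊛ : ∀ s k b r → paths (source s (suc (k + b))) r ≡ (paths (source s k) ⊛ paths b) r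
source-⊛ up   k b r = paths-⊛ r (suc k) b
source-⊛ down k b r = paths-⊛ r k b

-- From the insertion tree to the generating functions

module Avoiders (s : Direction) where

  open Weighted (λ k → paths (source s k)) (source-⊛ s) public

  -- Prepending letters leaves the heights of the old ones unchanged. Each of the `paths d r`
  -- descendants thus inherits the weight of σ, and `total` accounts for the letters added later.
  extendBy-Node : ∀ j r {n σ d} → Node s n σ d →
    extendBy s r n (weight (suc j)) σ ≡ weight (suc j) σ · paths d r + total (_choose suc j) d r
  extendBy-Node j zero    {σ = σ} node = sym (trans (+-identityʳ _) (*-identityʳ (weight (suc j) σ)))
  extendBy-Node j (suc r) {n} {σ} {d} node = begin
    extend s n (extendBy s r (suc n) (weight (suc j))) σ
      ≡⟨ extend-Node node (extendBy s r (suc n) (weight (suc j))) ⟩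
    sumTo (λ k → extendBy s r (suc n) (weight (suc j)) (insert (n ∸ k) σ)) d
      ≡⟨ sumTo-cong-≤ d step ⟩
    sumTo (λ k → (k choose suc j + weight (suc j) σ) · paths (child s d k) r + total (_choose suc j) (child s d k) r) d
      ≡⟨ sumTo-child s (_choose suc j) refl (λ e → paths e r) (λ e → total (_choose suc j) e r) (weight (suc j) σ) d ⟩
    weight (suc j) σ · paths d (suc r) + total (_choose suc j) d (suc r)
      ∎
    where
    open ≡-Reasoning
    step : ∀ k → k ≤ d → extendBy s r (suc n) (weight (suc j)) (insert (n ∸ k) σ)
         ≡ (k choose suc j + weight (suc j) σ) · paths (child s d k) r + total (_choose suc j) (child s d k) r
    step k k≤d = trans
      (extendBy-Node j r (Node-insert s node n∸k+k≡n k≤d))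
      (cong (λ w → w · paths (child s d k) r + total (_choose suc j) (child s d k) r)
        (trans (weight-insert (suc j) (n ∸ k) σ) (cong (λ l → l choose suc j + weight (suc j) σ) (count node n∸k+k≡n))))
      where
      n∸k+k≡n : n ∸ k + k ≡ n
      n∸k+k≡n = m∸n+n≡m (≤-trans k≤d (label≤ node))

  occurrences≗total : ∀ j → occurrences (pat (opposite s) 2) (pat s (suc j)) ≗ fromℕ ∘ total (_choose suc j) 0
  occurrences≗total j n = cong fromℕ (begin
    sum (map (occr (pat s (suc j))) (avoiders s n))
      ≡⟨ cong sum (map-cong-local (All.tabulate (λ {σ} σ∈ → occr≡weight s (suc j) σ (good σ∈)))) ⟩
    sum (map (weight (suc j)) (avoiders s n))
      ≡⟨ sum-avoiders s n (weight (suc j)) ⟩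
    extendBy s n 0 (weight (suc j)) []
      ≡⟨ extendBy-Node j n (root s) ⟩
    total (_choose suc j) 0 n
      ∎)
    where
    open ≡-Reasoning
    good : ∀ {σ} → σ ∈ avoiders s n → Good s σ
    good σ∈ with σ∈𝒮 , avoids ← ∈-filter⁻ (avoids? s) {xs = 𝒮 n} σ∈ =
      avoids⇒Good s (proj₁ (proj₂ (∈-𝒮⁻ n σ∈𝒮))) avoids

  occurrences-quotient : ∀ j →
    occurrences (pat (opposite s) 2) (pat s (2 + j)) ≗
    t * C * occurrences (pat (opposite s) 2) (pat s (1 + j)) / (one - two * t * C)
  occurrences-quotient j = recurrence⇒quotient (total (_choose (2 + j)) 0) (total (_choose (1 + j)) 0)
    (occurrences≗total (suc j)) (occurrences≗total j) refl
    -- With m = j + 3 the weights are C(k, m - 1) and C(k, m - 2), and Pascal's rule is the required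
    -- relation between them.
    (total-recurrence (_choose (2 + j)) (_choose (1 + j)) refl (λ k → pascal k (suc j)))

theorem10 : (m : ℕ) → m > 2 →
    (F (increasing m) ≗ t * C * F (increasing (m ∸ 1)) / (one - two * t * C))
    × (G (one-then-decreasing m) ≗ t * C * G (one-then-decreasing (m ∸ 1)) / (one - two * t * C))
-- For m = j + 3 the patterns of lengths m and m - 1 are `pat s (2 + j)` and `pat s (1 + j)`.
theorem10 (suc (suc (suc j))) _ = Avoiders.occurrences-quotient up j , Avoiders.occurrences-quotient down j
theorem10 (suc zero)       (s≤s ())
theorem10 (suc (suc zero)) (s≤s (s≤s ()))
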